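{- Let $n$ be a positive odd integer and let $s$ be an integer with $0\leqslant s\leqslant (n-1)/2$. Then $$ \sum_{k=0}^{(n-1)/2}\frac{(aq;q^2)_k\,(q/a;q^2)_{k+s}}{(q^2;q^2)_k\,(q^2;q^2)_{k+s} } \equiv (-1)^{(n-1)/2}q^{(1-n^2)/4}\pmod{(1-aq^n)(a-q^n)}. $$
   Context: $a,q$ are indeterminates. The $q$-shifted factorial is $(y;q)_0=1$ and $(y;q)_m=(1-y)(1-yq)\cdots(1-yq^{m-1})$ for $m\geqslant1$. For rational functions $A,B$ and a polynomial $P$, $A\equiv B\pmod P$ means $A-B=P\cdot C/D$ for polynomials $C,D$ with $D$ coprime to $P$. -}

module Defs where

open import Algebra.Bundles using (CommutativeRing; Semiring)
import Algebra.Definitions.RawSemiring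
import Algebra.Properties.Ring
import Algebra.Solver.Ring.NaturalCoefficients.Default
open import Data.Empty using (⊥-elim; ⊥-elim-irr)
open import Data.Fin.Base using (toℕ)
open import Data.Integer.Base using (ℤ; +_; -[1+_])
open import Data.List.Base using (List; []; _∷_; map)
open import Data.Nat.Base using (ℕ; zero; suc)
open import Data.Product.Base using (Σ-syntax; _×_; _,_)
import Data.Rational.Base as ℚ
import Data.Rational.Properties as ℚ
open import Data.Sum.Base using (_⊎_; inj₁; inj₂; map₁; map₂)
open import Level using (_⊔_; 0ℓ) renaming (suc to lsuc)
open import Relation.Binary.Bundles using (Setoid)
open import Relation.Binary.Definitions using (Decidable)
open import Relation.Binary.Structures using (IsEquivalence)
import Relation.Binary.PropositionalEquality as ≡
import Relation.Binary.Reasoning.Setoid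
open import Relation.Nullary.Decidable using (Dec; yes; no)
open import Relation.Nullary.Negation using (¬_)

-- An integral domain with decidable equality.
record Domain c ℓ : Set (lsuc (c ⊔ ℓ)) where
  field
    commutativeRing : CommutativeRing c ℓ
  open CommutativeRing commutativeRing public
  field
    _≟_      : Decidable _≈_
    1≉0      : ¬ (1# ≈ 0#)
    integral : ∀ {x y} → x * y ≈ 0# → x ≈ 0# ⊎ y ≈ 0#
  open Algebra.Definitions.RawSemiring (Semiring.rawSemiring semiring) public
    using (_^_; Coprime)

ℚ-domain : Domain 0ℓ 0ℓ
ℚ-domain = record
  { commutativeRing = ℚ.+-*-commutativeRing
  ; _≟_             = ℚ._≟_
  ; 1≉0             = λ ()
  ; integral        = integral′
  }
  where
  integral′ : ∀ {x y} → x ℚ.* y ≡.≡ ℚ.0ℚ → x ≡.≡ ℚ.0ℚ ⊎ y ≡.≡ ℚ.0ℚ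
  integral′ {x} {y} xy≡0 with x ℚ.≟ ℚ.0ℚ
  ... | yes x≡0 = inj₁ x≡0
  ... | no  x≢0 = inj₂ (begin
      y                         ≡⟨ ℚ.*-identityˡ y ⟨
      ℚ.1ℚ ℚ.* y                ≡⟨ ≡.cong (ℚ._* y) (ℚ.*-inverseˡ x) ⟨
      (ℚ.1/ x) ℚ.* x ℚ.* y      ≡⟨ ℚ.*-assoc (ℚ.1/ x) x y ⟩
      (ℚ.1/ x) ℚ.* (x ℚ.* y)    ≡⟨ ≡.cong ((ℚ.1/ x) ℚ.*_) xy≡0 ⟩
      (ℚ.1/ x) ℚ.* ℚ.0ℚ         ≡⟨ ℚ.*-zeroʳ (ℚ.1/ x) ⟩
      ℚ.0ℚ                      ∎)
    where
    open ≡.≡-Reasoning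
    instance _ = ℚ.≢-nonZero x≢0

-- Univariate polynomials: lists of coefficients, constant term first, two
-- lists being identified when they agree up to trailing zeros.
module Polynomial {c ℓ} (R : Domain c ℓ) where
  open Domain R
  open Algebra.Properties.Ring ring using (-0#≈0#)
  open Algebra.Solver.Ring.NaturalCoefficients.Default commutativeSemiring
    using (solve; _:=_; _:+_; _:*_)

  Poly : Set c
  Poly = List Carrier

  coeff : Poly → ℕ → Carrier
  coeff []      _       = 0#
  coeff (x ∷ p) zero    = x
  coeff (x ∷ p) (suc i) = coeff p i

  infix  4 _≈ₚ_
  infix  8 -ₚ_
  infixl 7 _*ₚ_ _·_
  infixl 6 _+ₚ_

  record _≈ₚ_ (p r : Poly) : Set ℓ where
    constructor mk≈ₚ
    field coeff-≈ : ∀ i → coeff p i ≈ coeff r i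
  open _≈ₚ_ public

  _+ₚ_ : Poly → Poly → Poly
  []      +ₚ r       = r
  (x ∷ p) +ₚ []      = x ∷ p
  (x ∷ p) +ₚ (y ∷ r) = (x + y) ∷ (p +ₚ r)

  _·_ : Carrier → Poly → Poly
  x · p = map (x *_) p

  -ₚ_ : Poly → Poly
  -ₚ_ = map (-_)

  _*ₚ_ : Poly → Poly → Poly
  []      *ₚ r = []
  (x ∷ p) *ₚ r = x · r +ₚ (0# ∷ p *ₚ r)

  const : Carrier → Poly
  const x = x ∷ []

  X : Poly
  X = 0# ∷ 1# ∷ []

  ≈ₚ-refl : ∀ {p} → p ≈ₚ p
  ≈ₚ-refl = mk≈ₚ λ _ → refl

  ≈ₚ-sym : ∀ {p r} → p ≈ₚ r → r ≈ₚ p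
  ≈ₚ-sym e = mk≈ₚ λ i → sym (coeff-≈ e i)

  ≈ₚ-trans : ∀ {p r t} → p ≈ₚ r → r ≈ₚ t → p ≈ₚ t
  ≈ₚ-trans e f = mk≈ₚ λ i → trans (coeff-≈ e i) (coeff-≈ f i)

  ≈ₚ-isEquivalence : IsEquivalence _≈ₚ_
  ≈ₚ-isEquivalence = record { refl = ≈ₚ-refl ; sym = ≈ₚ-sym ; trans = ≈ₚ-trans }

  ≈ₚ-setoid : Setoid c ℓ
  ≈ₚ-setoid = record { isEquivalence = ≈ₚ-isEquivalence }

  private
    open module ≈ₚ-Reasoning = Relation.Binary.Reasoning.Setoid ≈ₚ-setoid

  ∷-cong : ∀ {x y p r} → x ≈ y → p ≈ₚ r → (x ∷ p) ≈ₚ (y ∷ r)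
  ∷-cong e f = mk≈ₚ λ { zero → e ; (suc i) → coeff-≈ f i }

  head-≈ : ∀ {x y p r} → (x ∷ p) ≈ₚ (y ∷ r) → x ≈ y
  head-≈ e = coeff-≈ e 0

  tail-≈ : ∀ {x y p r} → (x ∷ p) ≈ₚ (y ∷ r) → p ≈ₚ r
  tail-≈ e = mk≈ₚ λ i → coeff-≈ e (suc i)

  ∷-≈[] : ∀ {x p} → x ≈ 0# → p ≈ₚ [] → (x ∷ p) ≈ₚ []
  ∷-≈[] e f = mk≈ₚ λ { zero → e ; (suc i) → coeff-≈ f i }

  head-≈[] : ∀ {x p} → (x ∷ p) ≈ₚ [] → x ≈ 0#
  head-≈[] e = coeff-≈ e 0

  tail-≈[] : ∀ {x p} → (x ∷ p) ≈ₚ [] → p ≈ₚ []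
  tail-≈[] e = mk≈ₚ λ i → coeff-≈ e (suc i)

  coeff-+ : ∀ p r i → coeff (p +ₚ r) i ≈ coeff p i + coeff r i
  coeff-+ []      r       i       = sym (+-identityˡ _)
  coeff-+ (x ∷ p) []      i       = sym (+-identityʳ _)
  coeff-+ (x ∷ p) (y ∷ r) zero    = refl
  coeff-+ (x ∷ p) (y ∷ r) (suc i) = coeff-+ p r i

  coeff-· : ∀ x p i → coeff (x · p) i ≈ x * coeff p i
  coeff-· x []      i       = sym (zeroʳ x)
  coeff-· x (y ∷ p) zero    = refl
  coeff-· x (y ∷ p) (suc i) = coeff-· x p i

  coeff-neg : ∀ p i → coeff (-ₚ p) i ≈ - coeff p i
  coeff-neg []      i       = sym -0#≈0#
  coeff-neg (y ∷ p) zero    = refl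
  coeff-neg (y ∷ p) (suc i) = coeff-neg p i

  +ₚ-cong : ∀ {p p′ r r′} → p ≈ₚ p′ → r ≈ₚ r′ → p +ₚ r ≈ₚ p′ +ₚ r′
  +ₚ-cong {p} {p′} {r} {r′} e f = mk≈ₚ λ i →
    trans (coeff-+ p r i)
      (trans (+-cong (coeff-≈ e i) (coeff-≈ f i)) (sym (coeff-+ p′ r′ i)))

  ·-cong : ∀ {x y p r} → x ≈ y → p ≈ₚ r → x · p ≈ₚ y · r
  ·-cong {x} {y} {p} {r} e f = mk≈ₚ λ i →
    trans (coeff-· x p i) (trans (*-cong e (coeff-≈ f i)) (sym (coeff-· y r i)))

  -ₚ-cong : ∀ {p r} → p ≈ₚ r → -ₚ p ≈ₚ -ₚ r
  -ₚ-cong {p} {r} e = mk≈ₚ λ i →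
    trans (coeff-neg p i) (trans (-‿cong (coeff-≈ e i)) (sym (coeff-neg r i)))

  +ₚ-assoc : ∀ p r t → (p +ₚ r) +ₚ t ≈ₚ p +ₚ (r +ₚ t)
  +ₚ-assoc p r t = mk≈ₚ λ i →
    trans (coeff-+ (p +ₚ r) t i) (trans (+-congʳ (coeff-+ p r i))
      (trans (+-assoc _ _ _)
        (sym (trans (coeff-+ p (r +ₚ t) i) (+-congˡ (coeff-+ r t i))))))

  +ₚ-comm : ∀ p r → p +ₚ r ≈ₚ r +ₚ p
  +ₚ-comm p r = mk≈ₚ λ i →
    trans (coeff-+ p r i) (trans (+-comm _ _) (sym (coeff-+ r p i)))

  +ₚ-identityʳ : ∀ p → p +ₚ [] ≈ₚ p
  +ₚ-identityʳ p = +ₚ-comm p []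

  -ₚ-inverseˡ : ∀ p → -ₚ p +ₚ p ≈ₚ []
  -ₚ-inverseˡ p = mk≈ₚ λ i →
    trans (coeff-+ (-ₚ p) p i) (trans (+-congʳ (coeff-neg p i)) (-‿inverseˡ _))

  -ₚ-inverseʳ : ∀ p → p +ₚ -ₚ p ≈ₚ []
  -ₚ-inverseʳ p = ≈ₚ-trans (+ₚ-comm p (-ₚ p)) (-ₚ-inverseˡ p)

  +ₚ-interchange : ∀ p r t u → (p +ₚ r) +ₚ (t +ₚ u) ≈ₚ (p +ₚ t) +ₚ (r +ₚ u)
  +ₚ-interchange p r t u = mk≈ₚ λ i →
    trans (coeff-+ (p +ₚ r) (t +ₚ u) i)
      (trans (+-cong (coeff-+ p r i) (coeff-+ t u i))
        (trans (solve 4 (λ a b c d → (a :+ b) :+ (c :+ d) := (a :+ c) :+ (b :+ d))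
                 refl (coeff p i) (coeff r i) (coeff t i) (coeff u i))
          (sym (trans (coeff-+ (p +ₚ t) (r +ₚ u) i)
            (+-cong (coeff-+ p t i) (coeff-+ r u i))))))

  ·-zeroˡ : ∀ {x} p → x ≈ 0# → x · p ≈ₚ []
  ·-zeroˡ {x} p e = mk≈ₚ λ i → trans (coeff-· x p i) (trans (*-congʳ e) (zeroˡ _))

  ·-identityˡ : ∀ p → 1# · p ≈ₚ p
  ·-identityˡ p = mk≈ₚ λ i → trans (coeff-· 1# p i) (*-identityˡ _)

  ·-assoc : ∀ x y p → (x * y) · p ≈ₚ x · (y · p)
  ·-assoc x y p = mk≈ₚ λ i →
    trans (coeff-· (x * y) p i) (trans (*-assoc _ _ _)
      (sym (trans (coeff-· x (y · p) i) (*-congˡ (coeff-· y p i)))))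

  ·-distribˡ : ∀ x p r → x · (p +ₚ r) ≈ₚ x · p +ₚ x · r
  ·-distribˡ x p r = mk≈ₚ λ i →
    trans (coeff-· x (p +ₚ r) i) (trans (*-congˡ (coeff-+ p r i))
      (trans (distribˡ _ _ _)
        (sym (trans (coeff-+ (x · p) (x · r) i)
          (+-cong (coeff-· x p i) (coeff-· x r i))))))

  ·-distribʳ : ∀ x y p → (x + y) · p ≈ₚ x · p +ₚ y · p
  ·-distribʳ x y p = mk≈ₚ λ i →
    trans (coeff-· (x + y) p i) (trans (distribʳ _ _ _)
      (sym (trans (coeff-+ (x · p) (y · p) i)
        (+-cong (coeff-· x p i) (coeff-· y p i)))))

  0∷-+ : ∀ p r → (0# ∷ (p +ₚ r)) ≈ₚ (0# ∷ p) +ₚ (0# ∷ r)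
  0∷-+ p r = ∷-cong (sym (+-identityˡ 0#)) ≈ₚ-refl

  ·-0∷ : ∀ x p → x · (0# ∷ p) ≈ₚ (0# ∷ x · p)
  ·-0∷ x p = ∷-cong (zeroʳ x) ≈ₚ-refl

  *ₚ-zeroʳ : ∀ p → p *ₚ [] ≈ₚ []
  *ₚ-zeroʳ []      = ≈ₚ-refl
  *ₚ-zeroʳ (x ∷ p) = ∷-≈[] refl (*ₚ-zeroʳ p)

  ≈[]⇒*ₚ≈[] : ∀ {p} r → p ≈ₚ [] → p *ₚ r ≈ₚ []
  ≈[]⇒*ₚ≈[] {[]}    r e = ≈ₚ-refl
  ≈[]⇒*ₚ≈[] {x ∷ p} r e =
    +ₚ-cong (·-zeroˡ r (head-≈[] e)) (∷-≈[] refl (≈[]⇒*ₚ≈[] r (tail-≈[] e)))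

  *ₚ-cong : ∀ {p p′ r r′} → p ≈ₚ p′ → r ≈ₚ r′ → p *ₚ r ≈ₚ p′ *ₚ r′
  *ₚ-cong {[]}    {[]}            e f = ≈ₚ-refl
  *ₚ-cong {[]}    {x ∷ p} {r} {r′} e f = ≈ₚ-sym (≈[]⇒*ₚ≈[] r′ (≈ₚ-sym e))
  *ₚ-cong {x ∷ p} {[]}    {r}      e f = ≈[]⇒*ₚ≈[] r e
  *ₚ-cong {x ∷ p} {y ∷ p′}         e f =
    +ₚ-cong (·-cong (head-≈ e) f) (∷-cong refl (*ₚ-cong (tail-≈ e) f))

  *ₚ-distribʳ : ∀ r p t → (p +ₚ t) *ₚ r ≈ₚ p *ₚ r +ₚ t *ₚ r
  *ₚ-distribʳ r []      t       = ≈ₚ-refl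
  *ₚ-distribʳ r (x ∷ p) []      = ≈ₚ-sym (+ₚ-identityʳ _)
  *ₚ-distribʳ r (x ∷ p) (y ∷ t) = begin
    (x + y) · r +ₚ (0# ∷ (p +ₚ t) *ₚ r)
      ≈⟨ +ₚ-cong (·-distribʳ x y r) (∷-cong refl (*ₚ-distribʳ r p t)) ⟩
    (x · r +ₚ y · r) +ₚ (0# ∷ (p *ₚ r +ₚ t *ₚ r))
      ≈⟨ +ₚ-cong ≈ₚ-refl (0∷-+ (p *ₚ r) (t *ₚ r)) ⟩
    (x · r +ₚ y · r) +ₚ ((0# ∷ p *ₚ r) +ₚ (0# ∷ t *ₚ r))
      ≈⟨ +ₚ-interchange (x · r) (y · r) _ _ ⟩
    (x ∷ p) *ₚ r +ₚ (y ∷ t) *ₚ r ∎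

  ·-*ₚ : ∀ x p r → (x · p) *ₚ r ≈ₚ x · (p *ₚ r)
  ·-*ₚ x []      r = ≈ₚ-refl
  ·-*ₚ x (y ∷ p) r = begin
    (x * y) · r +ₚ (0# ∷ (x · p) *ₚ r)
      ≈⟨ +ₚ-cong (·-assoc x y r) (∷-cong refl (·-*ₚ x p r)) ⟩
    x · (y · r) +ₚ (0# ∷ x · (p *ₚ r))
      ≈⟨ +ₚ-cong ≈ₚ-refl (·-0∷ x (p *ₚ r)) ⟨
    x · (y · r) +ₚ x · (0# ∷ p *ₚ r)
      ≈⟨ ·-distribˡ x (y · r) _ ⟨
    x · (y · r +ₚ (0# ∷ p *ₚ r)) ∎

  0∷-*ₚ : ∀ p r → (0# ∷ p) *ₚ r ≈ₚ (0# ∷ p *ₚ r)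
  0∷-*ₚ p r = +ₚ-cong (·-zeroˡ r refl) ≈ₚ-refl

  *ₚ-assoc : ∀ p r t → (p *ₚ r) *ₚ t ≈ₚ p *ₚ (r *ₚ t)
  *ₚ-assoc []      r t = ≈ₚ-refl
  *ₚ-assoc (x ∷ p) r t = begin
    (x · r +ₚ (0# ∷ p *ₚ r)) *ₚ t
      ≈⟨ *ₚ-distribʳ t (x · r) _ ⟩
    (x · r) *ₚ t +ₚ (0# ∷ p *ₚ r) *ₚ t
      ≈⟨ +ₚ-cong (·-*ₚ x r t) (0∷-*ₚ (p *ₚ r) t) ⟩
    x · (r *ₚ t) +ₚ (0# ∷ (p *ₚ r) *ₚ t)
      ≈⟨ +ₚ-cong ≈ₚ-refl (∷-cong refl (*ₚ-assoc p r t)) ⟩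
    x · (r *ₚ t) +ₚ (0# ∷ p *ₚ (r *ₚ t)) ∎

  *ₚ-∷ : ∀ p y r → p *ₚ (y ∷ r) ≈ₚ y · p +ₚ (0# ∷ p *ₚ r)
  *ₚ-∷ []      y r = ≈ₚ-sym (∷-≈[] refl ≈ₚ-refl)
  *ₚ-∷ (x ∷ p) y r = ∷-cong (+-congʳ (*-comm x y)) (begin
    x · r +ₚ p *ₚ (y ∷ r)
      ≈⟨ +ₚ-cong ≈ₚ-refl (*ₚ-∷ p y r) ⟩
    x · r +ₚ (y · p +ₚ (0# ∷ p *ₚ r))
      ≈⟨ +ₚ-assoc (x · r) (y · p) _ ⟨
    (x · r +ₚ y · p) +ₚ (0# ∷ p *ₚ r)
      ≈⟨ +ₚ-cong (+ₚ-comm (x · r) (y · p)) ≈ₚ-refl ⟩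
    (y · p +ₚ x · r) +ₚ (0# ∷ p *ₚ r)
      ≈⟨ +ₚ-assoc (y · p) (x · r) _ ⟩
    y · p +ₚ (x · r +ₚ (0# ∷ p *ₚ r)) ∎)

  *ₚ-comm : ∀ p r → p *ₚ r ≈ₚ r *ₚ p
  *ₚ-comm []      r = ≈ₚ-sym (*ₚ-zeroʳ r)
  *ₚ-comm (x ∷ p) r = begin
    x · r +ₚ (0# ∷ p *ₚ r)  ≈⟨ +ₚ-cong ≈ₚ-refl (∷-cong refl (*ₚ-comm p r)) ⟩
    x · r +ₚ (0# ∷ r *ₚ p)  ≈⟨ *ₚ-∷ r x p ⟨
    r *ₚ (x ∷ p)            ∎

  *ₚ-identityˡ : ∀ p → const 1# *ₚ p ≈ₚ p
  *ₚ-identityˡ p = begin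
    1# · p +ₚ (0# ∷ [])  ≈⟨ +ₚ-cong (·-identityˡ p) (∷-≈[] refl ≈ₚ-refl) ⟩
    p +ₚ []              ≈⟨ +ₚ-identityʳ p ⟩
    p                    ∎

  coeff-*-0 : ∀ p r → coeff (p *ₚ r) 0 ≈ coeff p 0 * coeff r 0
  coeff-*-0 []      r = sym (zeroˡ _)
  coeff-*-0 (x ∷ p) r = trans (coeff-+ (x · r) (0# ∷ p *ₚ r) 0)
    (trans (+-identityʳ _) (coeff-· x r 0))

  polyRing : CommutativeRing c ℓ
  polyRing = record
    { Carrier = Poly ; _≈_ = _≈ₚ_ ; _+_ = _+ₚ_ ; _*_ = _*ₚ_ ; -_ = -ₚ_
    ; 0# = [] ; 1# = const 1#
    ; isCommutativeRing = record
      { isRing = record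
        { +-isAbelianGroup = record
          { isGroup = record
            { isMonoid = record
              { isSemigroup = record
                { isMagma = record { isEquivalence = ≈ₚ-isEquivalence ; ∙-cong = +ₚ-cong }
                ; assoc = +ₚ-assoc }
              ; identity = (λ _ → ≈ₚ-refl) , +ₚ-identityʳ }
            ; inverse = -ₚ-inverseˡ , -ₚ-inverseʳ
            ; ⁻¹-cong = -ₚ-cong }
          ; comm = +ₚ-comm }
        ; *-cong = *ₚ-cong
        ; *-assoc = *ₚ-assoc
        ; *-identity = *ₚ-identityˡ , λ p → ≈ₚ-trans (*ₚ-comm p _) (*ₚ-identityˡ p)
        ; distrib = (λ p r t → ≈ₚ-trans (*ₚ-comm p (r +ₚ t))
                       (≈ₚ-trans (*ₚ-distribʳ p r t) (+ₚ-cong (*ₚ-comm r p) (*ₚ-comm t p))))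
                  , *ₚ-distribʳ }
      ; *-comm = *ₚ-comm } }

  _≟[] : ∀ p → Dec (p ≈ₚ [])
  []      ≟[] = yes ≈ₚ-refl
  (x ∷ p) ≟[] with x ≟ 0# | p ≟[]
  ... | yes e | yes f = yes (∷-≈[] e f)
  ... | no ¬e | _     = no λ e → ¬e (head-≈[] e)
  ... | _     | no ¬f = no λ e → ¬f (tail-≈[] e)

  _≟ₚ_ : Decidable _≈ₚ_
  []      ≟ₚ r with r ≟[]
  ... | yes e = yes (≈ₚ-sym e)
  ... | no ¬e = no λ e → ¬e (≈ₚ-sym e)
  (x ∷ p) ≟ₚ []      = (x ∷ p) ≟[]
  (x ∷ p) ≟ₚ (y ∷ r) with x ≟ y | p ≟ₚ r
  ... | yes e | yes f = yes (∷-cong e f)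
  ... | no ¬e | _     = no λ e → ¬e (head-≈ e)
  ... | _     | no ¬f = no λ e → ¬f (tail-≈ e)

  private
    integral-step : ∀ x p y r →
      (p *ₚ (y ∷ r) ≈ₚ [] → p ≈ₚ [] ⊎ (y ∷ r) ≈ₚ []) →
      ((x ∷ p) *ₚ r ≈ₚ [] → (x ∷ p) ≈ₚ [] ⊎ r ≈ₚ []) →
      (x ∷ p) *ₚ (y ∷ r) ≈ₚ [] → (x ∷ p) ≈ₚ [] ⊎ (y ∷ r) ≈ₚ []
    integral-step x p y r recˡ recʳ e with x ≟ 0# | y ≟ 0#
    ... | yes x≈0 | _ = map₁ (∷-≈[] x≈0) (recˡ (tail-≈[] (begin
        0# ∷ p *ₚ (y ∷ r)    ≈⟨ 0∷-*ₚ p (y ∷ r) ⟨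
        (0# ∷ p) *ₚ (y ∷ r)  ≈⟨ *ₚ-cong {x ∷ p} {0# ∷ p} {y ∷ r} (∷-cong x≈0 ≈ₚ-refl) ≈ₚ-refl ⟨
        (x ∷ p) *ₚ (y ∷ r)   ≈⟨ e ⟩
        []                   ∎)))
    ... | no _ | yes y≈0 = map₂ (∷-≈[] y≈0) (recʳ (tail-≈[] (begin
        0# ∷ (x ∷ p) *ₚ r                   ≈⟨ +ₚ-cong (·-zeroˡ (x ∷ p) y≈0) ≈ₚ-refl ⟨
        y · (x ∷ p) +ₚ (0# ∷ (x ∷ p) *ₚ r)  ≈⟨ *ₚ-∷ (x ∷ p) y r ⟨
        (x ∷ p) *ₚ (y ∷ r)                  ≈⟨ e ⟩
        []                                  ∎)))
    ... | no x≉0 | no y≉0 with integral (trans (sym (+-identityʳ (x * y))) (head-≈[] e))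
    ...   | inj₁ x≈0 = ⊥-elim (x≉0 x≈0)
    ...   | inj₂ y≈0 = ⊥-elim (y≉0 y≈0)

  integralₚ : ∀ p r → p *ₚ r ≈ₚ [] → p ≈ₚ [] ⊎ r ≈ₚ []
  integralₚ []      r       = λ _ → inj₁ ≈ₚ-refl
  integralₚ (x ∷ p) []      = λ _ → inj₂ ≈ₚ-refl
  integralₚ (x ∷ p) (y ∷ r) =
    integral-step x p y r (integralₚ p (y ∷ r)) (integralₚ (x ∷ p) r)

  polyDomain : Domain c ℓ
  polyDomain = record
    { commutativeRing = polyRing
    ; _≟_             = _≟ₚ_
    ; 1≉0             = λ e → 1≉0 (head-≈[] e)
    ; integral        = λ {p} {r} → integralₚ p r
    }

module FractionField {c ℓ} (R : Domain c ℓ) where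
  open Domain R
  open Algebra.Properties.Ring ring using (-‿distribˡ-*; x∙y⁻¹≈ε⇒x≈y)
  open Algebra.Solver.Ring.NaturalCoefficients.Default commutativeSemiring
    using (solve; _:=_; _:+_; _:*_; con)
  private
    open module R-Reasoning = Relation.Binary.Reasoning.Setoid setoid

  record Frac : Set (c ⊔ ℓ) where
    constructor frac
    field
      num    : Carrier
      den    : Carrier
      .den≉0 : ¬ (den ≈ 0#)
  open Frac public

  infix  4 _≈ᶠ_
  infix  8 -ᶠ_ _⁻¹
  infixl 7 _*ᶠ_ _/_
  infixl 6 _+ᶠ_

  record _≈ᶠ_ (x y : Frac) : Set ℓ where
    constructor mk≈ᶠ
    field cross-≈ : num x * den y ≈ num y * den x
  open _≈ᶠ_ public

  *-≉0 : ∀ {x y} → ¬ (x ≈ 0#) → ¬ (y ≈ 0#) → ¬ (x * y ≈ 0#)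
  *-≉0 x≉0 y≉0 e with integral e
  ... | inj₁ x≈0 = x≉0 x≈0
  ... | inj₂ y≈0 = y≉0 y≈0

  *-cancelʳ : ∀ {x y z} → .(¬ (z ≈ 0#)) → x * z ≈ y * z → x ≈ y
  *-cancelʳ {x} {y} {z} z≉0 e with integral {x - y} {z} (begin
      (x - y) * z        ≈⟨ distribʳ z x (- y) ⟩
      x * z + - y * z    ≈⟨ +-cong e (sym (-‿distribˡ-* y z)) ⟩
      y * z + - (y * z)  ≈⟨ -‿inverseʳ (y * z) ⟩
      0#                 ∎)
  ... | inj₁ x-y≈0 = x∙y⁻¹≈ε⇒x≈y x y x-y≈0
  ... | inj₂ z≈0   = ⊥-elim-irr (z≉0 z≈0)

  ι : Carrier → Frac
  ι x = frac x 1# 1≉0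

  0ᶠ 1ᶠ : Frac
  0ᶠ = ι 0#
  1ᶠ = ι 1#

  _+ᶠ_ _*ᶠ_ : Frac → Frac → Frac
  frac m d d≉0 +ᶠ frac n e e≉0 = frac (m * e + n * d) (d * e) (*-≉0 d≉0 e≉0)
  frac m d d≉0 *ᶠ frac n e e≉0 = frac (m * n) (d * e) (*-≉0 d≉0 e≉0)

  -ᶠ_ : Frac → Frac
  -ᶠ frac m d d≉0 = frac (- m) d d≉0

  -- Totalised by 0⁻¹ = 0.
  _⁻¹ : Frac → Frac
  frac m d d≉0 ⁻¹ with m ≟ 0#
  ... | yes _   = 0ᶠ
  ... | no  m≉0 = frac d m m≉0

  _/_ : Frac → Frac → Frac
  x / y = x *ᶠ y ⁻¹

  ≈ᶠ-refl : ∀ {x} → x ≈ᶠ x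
  ≈ᶠ-refl = mk≈ᶠ refl

  ≈ᶠ-sym : ∀ {x y} → x ≈ᶠ y → y ≈ᶠ x
  ≈ᶠ-sym e = mk≈ᶠ (sym (cross-≈ e))

  ≈ᶠ-trans : ∀ {x y z} → x ≈ᶠ y → y ≈ᶠ z → x ≈ᶠ z
  ≈ᶠ-trans {frac m d _} {frac n e e≉0} {frac o f _} (mk≈ᶠ p) (mk≈ᶠ q) =
    mk≈ᶠ (*-cancelʳ e≉0 (begin
      m * f * e  ≈⟨ solve 3 (λ m f e → m :* f :* e := m :* e :* f) refl m f e ⟩
      m * e * f  ≈⟨ *-congʳ p ⟩
      n * d * f  ≈⟨ solve 3 (λ n d f → n :* d :* f := n :* f :* d) refl n d f ⟩
      n * f * d  ≈⟨ *-congʳ q ⟩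
      o * e * d  ≈⟨ solve 3 (λ o e d → o :* e :* d := o :* d :* e) refl o e d ⟩
      o * d * e  ∎))

  +ᶠ-cong : ∀ {x x′ y y′} → x ≈ᶠ x′ → y ≈ᶠ y′ → x +ᶠ y ≈ᶠ x′ +ᶠ y′
  +ᶠ-cong {frac m d _} {frac m′ d′ _} {frac n e _} {frac n′ e′ _} (mk≈ᶠ p) (mk≈ᶠ q) =
    mk≈ᶠ (begin
      (m * e + n * d) * (d′ * e′)
        ≈⟨ solve 6 (λ m d n e d′ e′ → (m :* e :+ n :* d) :* (d′ :* e′)
             := (m :* d′) :* (e :* e′) :+ (n :* e′) :* (d :* d′)) refl m d n e d′ e′ ⟩
      (m * d′) * (e * e′) + (n * e′) * (d * d′)
        ≈⟨ +-cong (*-congʳ p) (*-congʳ q) ⟩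
      (m′ * d) * (e * e′) + (n′ * e) * (d * d′)
        ≈⟨ solve 6 (λ m′ d n′ e d′ e′ → (m′ :* d) :* (e :* e′) :+ (n′ :* e) :* (d :* d′)
             := (m′ :* e′ :+ n′ :* d′) :* (d :* e)) refl m′ d n′ e d′ e′ ⟩
      (m′ * e′ + n′ * d′) * (d * e) ∎)

  *ᶠ-cong : ∀ {x x′ y y′} → x ≈ᶠ x′ → y ≈ᶠ y′ → x *ᶠ y ≈ᶠ x′ *ᶠ y′
  *ᶠ-cong {frac m d _} {frac m′ d′ _} {frac n e _} {frac n′ e′ _} (mk≈ᶠ p) (mk≈ᶠ q) =
    mk≈ᶠ (begin
      (m * n) * (d′ * e′)
        ≈⟨ solve 4 (λ m n d′ e′ → (m :* n) :* (d′ :* e′) := (m :* d′) :* (n :* e′)) refl m n d′ e′ ⟩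
      (m * d′) * (n * e′)
        ≈⟨ *-cong p q ⟩
      (m′ * d) * (n′ * e)
        ≈⟨ solve 4 (λ m n d e → (m :* d) :* (n :* e) := (m :* n) :* (d :* e)) refl m′ n′ d e ⟩
      (m′ * n′) * (d * e) ∎)

  -ᶠ-cong : ∀ {x y} → x ≈ᶠ y → -ᶠ x ≈ᶠ -ᶠ y
  -ᶠ-cong {frac m d _} {frac n e _} (mk≈ᶠ p) = mk≈ᶠ
    (trans (sym (-‿distribˡ-* m e)) (trans (-‿cong p) (-‿distribˡ-* n d)))

  +ᶠ-assoc : ∀ x y z → (x +ᶠ y) +ᶠ z ≈ᶠ x +ᶠ (y +ᶠ z)
  +ᶠ-assoc (frac m d _) (frac n e _) (frac o f _) = mk≈ᶠ
    (solve 6 (λ m d n e o f →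
        ((m :* e :+ n :* d) :* f :+ o :* (d :* e)) :* (d :* (e :* f))
        := (m :* (e :* f) :+ (n :* f :+ o :* e) :* d) :* (d :* e :* f)) refl m d n e o f)

  +ᶠ-comm : ∀ x y → x +ᶠ y ≈ᶠ y +ᶠ x
  +ᶠ-comm (frac m d _) (frac n e _) = mk≈ᶠ (*-cong (+-comm _ _) (*-comm e d))

  +ᶠ-identityˡ : ∀ x → 0ᶠ +ᶠ x ≈ᶠ x
  +ᶠ-identityˡ (frac m d _) = mk≈ᶠ
    (solve 2 (λ m d → (con 0 :* d :+ m :* con 1) :* d := m :* (con 1 :* d)) refl m d)

  -ᶠ-inverseˡ : ∀ x → -ᶠ x +ᶠ x ≈ᶠ 0ᶠ
  -ᶠ-inverseˡ (frac m d _) = mk≈ᶠ (trans (*-congʳ (begin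
      - m * d + m * d  ≈⟨ distribʳ d (- m) m ⟨
      (- m + m) * d    ≈⟨ *-congʳ (-‿inverseˡ m) ⟩
      0# * d           ≈⟨ zeroˡ d ⟩
      0#               ∎)) (trans (zeroˡ _) (sym (zeroˡ _))))

  *ᶠ-assoc : ∀ x y z → (x *ᶠ y) *ᶠ z ≈ᶠ x *ᶠ (y *ᶠ z)
  *ᶠ-assoc (frac m d _) (frac n e _) (frac o f _) = mk≈ᶠ
    (*-cong (*-assoc m n o) (sym (*-assoc d e f)))

  *ᶠ-comm : ∀ x y → x *ᶠ y ≈ᶠ y *ᶠ x
  *ᶠ-comm (frac m d _) (frac n e _) = mk≈ᶠ (*-cong (*-comm m n) (*-comm e d))

  *ᶠ-identityˡ : ∀ x → 1ᶠ *ᶠ x ≈ᶠ x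
  *ᶠ-identityˡ (frac m d _) = mk≈ᶠ
    (solve 2 (λ m d → (con 1 :* m) :* d := m :* (con 1 :* d)) refl m d)

  *ᶠ-distribʳ : ∀ z x y → (x +ᶠ y) *ᶠ z ≈ᶠ x *ᶠ z +ᶠ y *ᶠ z
  *ᶠ-distribʳ (frac o f _) (frac m d _) (frac n e _) = mk≈ᶠ
    (solve 6 (λ m d n e o f →
        ((m :* e :+ n :* d) :* o) :* ((d :* f) :* (e :* f))
        := ((m :* o) :* (e :* f) :+ (n :* o) :* (d :* f)) :* ((d :* e) :* f)) refl m d n e o f)

  fracRing : CommutativeRing (c ⊔ ℓ) ℓ
  fracRing = record
    { Carrier = Frac ; _≈_ = _≈ᶠ_ ; _+_ = _+ᶠ_ ; _*_ = _*ᶠ_ ; -_ = -ᶠ_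
    ; 0# = 0ᶠ ; 1# = 1ᶠ
    ; isCommutativeRing = record
      { isRing = record
        { +-isAbelianGroup = record
          { isGroup = record
            { isMonoid = record
              { isSemigroup = record
                { isMagma = record
                  { isEquivalence = record { refl = ≈ᶠ-refl ; sym = ≈ᶠ-sym ; trans = ≈ᶠ-trans }
                  ; ∙-cong = +ᶠ-cong }
                ; assoc = +ᶠ-assoc }
              ; identity = +ᶠ-identityˡ
                         , λ x → ≈ᶠ-trans (+ᶠ-comm x 0ᶠ) (+ᶠ-identityˡ x) }
            ; inverse = -ᶠ-inverseˡ
                      , λ x → ≈ᶠ-trans (+ᶠ-comm x (-ᶠ x)) (-ᶠ-inverseˡ x)
            ; ⁻¹-cong = -ᶠ-cong }
          ; comm = +ᶠ-comm }
        ; *-cong = *ᶠ-cong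
        ; *-assoc = *ᶠ-assoc
        ; *-identity = *ᶠ-identityˡ
                     , λ x → ≈ᶠ-trans (*ᶠ-comm x 1ᶠ) (*ᶠ-identityˡ x)
        ; distrib = (λ x y z → ≈ᶠ-trans (*ᶠ-comm x (y +ᶠ z))
                       (≈ᶠ-trans (*ᶠ-distribʳ x y z) (+ᶠ-cong (*ᶠ-comm y x) (*ᶠ-comm z x))))
                  , *ᶠ-distribʳ }
      ; *-comm = *ᶠ-comm } }

  ⁻¹-inverseʳ : ∀ x → ¬ (x ≈ᶠ 0ᶠ) → x *ᶠ x ⁻¹ ≈ᶠ 1ᶠ
  ⁻¹-inverseʳ (frac m d d≉0) x≉0 with m ≟ 0#
  ... | yes m≈0 = ⊥-elim (x≉0 (mk≈ᶠ (begin
      m * 1#   ≈⟨ *-identityʳ m ⟩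
      m        ≈⟨ m≈0 ⟩
      0#       ≈⟨ zeroˡ d ⟨
      0# * d   ∎)))
  ... | no _ = mk≈ᶠ
    (solve 2 (λ m d → (m :* d) :* con 1 := con 1 :* (d :* m)) refl m d)

  *ᶠ-≉0 : ∀ {x y} → ¬ (x ≈ᶠ 0ᶠ) → ¬ (y ≈ᶠ 0ᶠ) → ¬ (x *ᶠ y ≈ᶠ 0ᶠ)
  *ᶠ-≉0 x≉0 y≉0 e = *-≉0 (λ m≈0 → x≉0 (num≈0⇒≈0 m≈0)) (λ n≈0 → y≉0 (num≈0⇒≈0 n≈0))
    (trans (sym (*-identityʳ _)) (trans (cross-≈ e) (zeroˡ _)))
    where
    num≈0⇒≈0 : ∀ {x} → num x ≈ 0# → x ≈ᶠ 0ᶠ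
    num≈0⇒≈0 p = mk≈ᶠ (trans (*-identityʳ _) (trans p (sym (zeroˡ _))))

  ι-injective : ∀ {x y} → ι x ≈ᶠ ι y → x ≈ y
  ι-injective (mk≈ᶠ e) = trans (sym (*-identityʳ _)) (trans e (*-identityʳ _))

  ι-cong : ∀ {x y} → x ≈ y → ι x ≈ᶠ ι y
  ι-cong e = mk≈ᶠ (*-congʳ e)

  ι-+ : ∀ x y → ι (x + y) ≈ᶠ ι x +ᶠ ι y
  ι-+ x y = mk≈ᶠ (solve 2 (λ x y → (x :+ y) :* (con 1 :* con 1)
                    := (x :* con 1 :+ y :* con 1) :* con 1) refl x y)

  ι-* : ∀ x y → ι (x * y) ≈ᶠ ι x *ᶠ ι y
  ι-* x y = mk≈ᶠ (*-congˡ (*-identityʳ 1#))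

  ι-neg : ∀ x → ι (- x) ≈ᶠ -ᶠ ι x
  ι-neg x = ≈ᶠ-refl

-- Generic in R so that proofs about these operations are checked without
-- unfolding concrete polynomials.
module Fractions {c ℓ} (R : Domain c ℓ) where
  private module R = Domain R

  open FractionField R public
    using (ι; _⁻¹; _/_; ⁻¹-inverseʳ; *ᶠ-≉0; ι-injective; ι-cong; ι-+; ι-*; ι-neg)
    renaming (fracRing to commutativeRing)

  open CommutativeRing commutativeRing public
  open Algebra.Definitions.RawSemiring (Semiring.rawSemiring semiring) public
    using (_^_; sum)

  infixr 8 _^ᶻ_
  _^ᶻ_ : Carrier → ℤ → Carrier
  x ^ᶻ (+ m)    = x ^ m
  x ^ᶻ -[1+ m ] = (x ^ suc m) ⁻¹

  -- ⟨ y ⨾ b ⟩ m  is the shifted factorial (y; b)_m.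
  infix 9 ⟨_⨾_⟩_
  ⟨_⨾_⟩_ : Carrier → Carrier → ℕ → Carrier
  ⟨ y ⨾ b ⟩ zero  = 1#
  ⟨ y ⨾ b ⟩ suc m = ⟨ y ⨾ b ⟩ m * (1# - y * b ^ m)

  -- The upper bound is inclusive: m + 1 terms.
  ∑≤ : ℕ → (ℕ → Carrier) → Carrier
  ∑≤ m f = sum {suc m} (λ k → f (toℕ k))

  infix 5 ∑≤
  syntax ∑≤ m (λ k → x) = ∑[ k ⩽ m ] x

  Congruent : Carrier → Carrier → R.Carrier → Set (c ⊔ ℓ)
  Congruent A B P =
    Σ[ C ∈ R.Carrier ] Σ[ D ∈ R.Carrier ]
      ¬ (D R.≈ R.0#) × R.Coprime D P × A - B ≈ ι P * (ι C / ι D)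

  ^-≉0 : ∀ {x} → ¬ (x ≈ 0#) → ∀ m → ¬ (x ^ m ≈ 0#)
  ^-≉0 x≉0 zero    e = R.1≉0 (ι-injective e)
  ^-≉0 x≉0 (suc m) e = *ᶠ-≉0 x≉0 (^-≉0 x≉0 m) e

  ^-cong : ∀ m {x y} → x ≈ y → x ^ m ≈ y ^ m
  ^-cong zero    f = refl
  ^-cong (suc m) f = *-cong f (^-cong m f)

  ι-^ : ∀ x m → ι (x R.^ m) ≈ ι x ^ m
  ι-^ x zero    = refl
  ι-^ x (suc m) = trans (ι-* x (x R.^ m)) (*-congˡ {ι x} (ι-^ x m))

  ⟨x²⨾x²⟩≉0 : ∀ {x} → (∀ w → ¬ (R.1# R.≈ x R.* w)) →
              ∀ m → ¬ (⟨ ι x ^ 2 ⨾ ι x ^ 2 ⟩ m ≈ 0#)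
  ⟨x²⨾x²⟩≉0 {x} 1≉x* zero    e = R.1≉0 (ι-injective e)
  ⟨x²⨾x²⟩≉0 {x} 1≉x* (suc m) e = *ᶠ-≉0 (⟨x²⨾x²⟩≉0 1≉x* m) factor≉0 e
    where
    open Algebra.Properties.Ring ring using (x∙y⁻¹≈ε⇒x≈y)
    w : R.Carrier
    w = (x R.^ 1) R.* (x R.^ 2) R.^ m
    x²x²ᵐ≈xw : ι x ^ 2 * (ι x ^ 2) ^ m ≈ ι (x R.* w)
    x²x²ᵐ≈xw = trans (*-assoc (ι x) (ι x ^ 1) ((ι x ^ 2) ^ m)) (trans (*-congˡ {ι x} (sym
      (trans (ι-* (x R.^ 1) _) (*-cong (ι-^ x 1)
        (trans (ι-^ (x R.^ 2) m) (^-cong m (ι-^ x 2))))))) (sym (ι-* x w)))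
    factor≉0 : ¬ (1# - ι x ^ 2 * (ι x ^ 2) ^ m ≈ 0#)
    factor≉0 f = 1≉x* w (ι-injective (trans (x∙y⁻¹≈ε⇒x≈y _ _ f) x²x²ᵐ≈xw))

module ℚ[q] = Polynomial ℚ-domain

-- ℚ[a, q], realised as (ℚ[q])[a].
module Polynomials where
  module ℚ[q][a] = Polynomial ℚ[q].polyDomain

  domain : Domain 0ℓ 0ℓ
  domain = ℚ[q][a].polyDomain

  open Domain domain public

  a q : Carrier
  a = ℚ[q][a].X
  q = ℚ[q][a].const ℚ[q].X

-- The field ℚ(a, q).
module RationalFunctions where
  open Fractions Polynomials.domain public

  a q : Carrier
  a = ι Polynomials.a
  q = ι Polynomials.q

infix 4 _≡_[mod_]
_≡_[mod_] : RationalFunctions.Carrier → RationalFunctions.Carrier →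
            Polynomials.Carrier → Set
_≡_[mod_] = RationalFunctions.Congruent

-- These lemmas show that the convention 0⁻¹ = 0 does not affect expressions
-- whose denominators are products of powers of a, q and (q²; q²)_m.
module Nonvanishing where
  open RationalFunctions
  private
    module P = Polynomials
    module P₁ = P.ℚ[q][a]

  1≉q* : ∀ w → ¬ (P.1# P.≈ P.q P.* w)
  1≉q* w e with ≡.trans (ℚ[q].coeff-≈ (P₁.coeff-≈ e 0) 0)
      (≡.trans (ℚ[q].coeff-≈ (P₁.coeff-*-0 P.q w) 0)
        (≡.trans (ℚ[q].coeff-*-0 ℚ[q].X (P₁.coeff w 0)) (ℚ.*-zeroˡ (ℚ[q].coeff (P₁.coeff w 0) 0))))
  ... | ()

  a≉0 : ¬ (a ≈ 0#)
  a≉0 e with ℚ[q].coeff-≈ (P₁.coeff-≈ (ι-injective e) 1) 0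
  ... | ()

  q≉0 : ¬ (q ≈ 0#)
  q≉0 e with ℚ[q].coeff-≈ (P₁.coeff-≈ (ι-injective e) 0) 1
  ... | ()

  q^≉0 : ∀ m → ¬ (q ^ m ≈ 0#)
  q^≉0 = ^-≉0 q≉0

  ⟨q²⨾q²⟩≉0 : ∀ m → ¬ (⟨ q ^ 2 ⨾ q ^ 2 ⟩ m ≈ 0#)
  ⟨q²⨾q²⟩≉0 = ⟨x²⨾x²⟩≉0 {Polynomials.q} 1≉q*

{-# OPTIONS --safe #-}
-- Write n = 2m + 1, Q = q² and u = qⁿ.  Modulo a - u, respectively 1 - au, the
-- variable a may be replaced by u, respectively u⁻¹; the summand becomes a
-- product of (Q⁻ᵐ; Q) and (Qᵐ⁺¹; Q) shifted factorials.  Up to the factor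
-- (-1)ᵐ Q^{m(m+1)/2} (Q; Q)ₘ, either sum is then the operator
-- (E - Q)(E - Q²)⋯(E - Qᵐ), E : y ↦ yQ, applied to (y; Q)ₘ; since E - Qⁱ maps
-- (y; Q)ᵢ to (1 - Qⁱ)(yQ; Q)ᵢ₋₁, the result is (Q; Q)ₘ for every y.  The two
-- congruences combine because (1 - au) + u(a - u) = 1 - u² involves only q, and
-- all denominators have the form aⁱ d(q), which is coprime to (1 - au)(a - u).
module Submission where

open import Defs
open import Algebra.Bundles using (CommutativeRing; RawRing; Semiring)
import Algebra.Definitions.RawSemiring
open import Algebra.Definitions.RawMagma using (_,_)
import Algebra.Properties.AbelianGroup
import Algebra.Properties.CommutativeSemigroup
import Algebra.Properties.Ring
import Algebra.Properties.Semiring.Exp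
import Algebra.Properties.Semiring.Mult
import Algebra.Solver.Ring
import Algebra.Solver.Ring.NaturalCoefficients.Default
open import Algebra.Solver.Ring.AlmostCommutativeRing using (fromCommutativeRing; _-Raw-AlmostCommutative⟶_)
open import Data.Empty using (⊥-elim)
open import Data.Fin.Base using (toℕ)
open import Data.Integer.Base as ℤ using (+_)
import Data.Integer.Properties as ℤ
open import Data.List.Base using ([]; _∷_)
open import Data.Maybe.Base using (Maybe; just; nothing)
open import Data.Nat.Base as ℕ using (ℕ; zero; suc)
open import Data.Nat.Divisibility using (_∣_; divides)
import Data.Nat.DivMod as ℕ
import Data.Nat.Properties as ℕ
open import Data.Nat.Solver using (module +-*-Solver)
open import Data.Product.Base using (_×_; _,_; Σ-syntax; ∃)
import Data.Product.Properties as ×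
open import Data.Sum.Base using (inj₁; inj₂)
open import Level using (_⊔_) renaming (suc to lsuc)
open import Relation.Binary.PropositionalEquality as ≡ using (_≡_)
import Relation.Binary.Reasoning.Setoid
open import Relation.Nullary.Decidable using (yes; no)
open import Relation.Nullary.Negation using (¬_)

-- In a field every congruence holds, so the quotient in `_~_[_]` is confined to the subring of
-- fractions with denominators aⁱ d(q). This subring also contains 1/a, 1/q and 1/(q²; q²)ₖ, so the
-- substitution for a is made factor by factor in the sum itself, without a common denominator. The
-- constant (-1)ᵐ Q^{m(m+1)/2} is `δ m 0`, the constant term of the operator. Nothing is divided by
-- it: either specialised sum and the right side are each shown to be an inverse of it, and inverses
-- are unique. The parameter s is harmless in one specialisation, where it only changes y. In the
-- other it shifts the index of the operator coefficients, and the sum must first be completed to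
-- all of 0, ..., m.

-- A ring solver with integer coefficients.

-- The coefficients are formal differences (m , n) = m - n of naturals.
module RingSolver {c ℓ} (F : CommutativeRing c ℓ) where
  open CommutativeRing F hiding (zero)
  open Algebra.Properties.Ring ring using (-‿distribˡ-*; -‿distribʳ-*; -0#≈0#; -‿involutive)
  open Algebra.Properties.AbelianGroup +-abelianGroup using (⁻¹-∙-comm)
  open Algebra.Properties.Semiring.Mult semiring
    using (×-homo-+; ×1-homo-*) renaming (_×_ to _⨯_)
  open Relation.Binary.Reasoning.Setoid setoid
  private
    module Nat = Algebra.Solver.Ring.NaturalCoefficients.Default commutativeSemiring

    nat : ℕ → Carrier
    nat m = m ⨯ 1#

    -- The first two clauses make `:0` and `:1` denote `0#` and `1#` themselves, so that solved
    -- equations have the shape of the goals.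
    ⟦_⟧ : ℕ × ℕ → Carrier
    ⟦ 0 , 0 ⟧ = 0#
    ⟦ 1 , 0 ⟧ = 1#
    ⟦ m , n ⟧ = nat m - nat n

    ⟦⟧≈ : ∀ m n → ⟦ m , n ⟧ ≈ nat m - nat n
    ⟦⟧≈ 0             0       = sym (-‿inverseʳ 0#)
    ⟦⟧≈ 1             0       = sym (trans (+-cong (+-identityʳ 1#) -0#≈0#) (+-identityʳ 1#))
    ⟦⟧≈ 0             (suc _) = refl
    ⟦⟧≈ 1             (suc _) = refl
    ⟦⟧≈ (suc (suc _)) _       = refl

    interchange : ∀ a b c d → (a + b) + (c + d) ≈ (a + c) + (b + d)
    interchange = Nat.solve 4 (λ a b c d → (a :+ b) :+ (c :+ d) := (a :+ c) :+ (b :+ d)) refl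
      where
      open Nat using (_:=_; _:+_)

    -- The solver compares normal forms syntactically, so equal coefficients must be identical.
    reduce : ℕ → ℕ → ℕ × ℕ
    reduce (suc m) (suc n) = reduce m n
    reduce m       n       = m , n

    reduce-≈ : ∀ m n → ⟦ reduce m n ⟧ ≈ nat m - nat n
    reduce-≈ zero    n       = ⟦⟧≈ zero n
    reduce-≈ (suc m) zero    = ⟦⟧≈ (suc m) zero
    reduce-≈ (suc m) (suc n) = begin
      ⟦ reduce m n ⟧                    ≈⟨ reduce-≈ m n ⟩
      nat m - nat n                     ≈⟨ +-identityˡ _ ⟨
      0# + (nat m - nat n)              ≈⟨ +-congʳ (-‿inverseʳ 1#) ⟨
      (1# - 1#) + (nat m - nat n)       ≈⟨ interchange 1# (- 1#) (nat m) (- nat n) ⟩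
      (1# + nat m) + (- 1# - nat n)     ≈⟨ +-congˡ (⁻¹-∙-comm 1# (nat n)) ⟩
      nat (suc m) - nat (suc n)         ∎

    Diff : RawRing _ _
    Diff = record
      { Carrier = ℕ × ℕ
      ; _≈_ = _≡_
      ; _+_ = λ (m , n) (m′ , n′) → reduce (m ℕ.+ m′) (n ℕ.+ n′)
      ; _*_ = λ (m , n) (m′ , n′) → reduce (m ℕ.* m′ ℕ.+ n ℕ.* n′) (m ℕ.* n′ ℕ.+ n ℕ.* m′)
      ; -_ = λ (m , n) → n , m
      ; 0# = 0 , 0
      ; 1# = 1 , 0
      }
    module D = RawRing Diff

    +-homo : ∀ x y → ⟦ x D.+ y ⟧ ≈ ⟦ x ⟧ + ⟦ y ⟧
    +-homo x@(m , n) y@(m′ , n′) = begin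
      ⟦ x D.+ y ⟧
        ≈⟨ reduce-≈ (m ℕ.+ m′) (n ℕ.+ n′) ⟩
      nat (m ℕ.+ m′) - nat (n ℕ.+ n′)
        ≈⟨ +-cong (×-homo-+ 1# m m′) (trans (-‿cong (×-homo-+ 1# n n′)) (sym (⁻¹-∙-comm _ _))) ⟩
      (nat m + nat m′) + (- nat n + - nat n′)
        ≈⟨ interchange (nat m) (nat m′) (- nat n) (- nat n′) ⟩
      (nat m - nat n) + (nat m′ - nat n′)
        ≈⟨ +-cong (⟦⟧≈ m n) (⟦⟧≈ m′ n′) ⟨
      ⟦ x ⟧ + ⟦ y ⟧ ∎

    *-homo : ∀ x y → ⟦ x D.* y ⟧ ≈ ⟦ x ⟧ * ⟦ y ⟧
    *-homo x@(m , n) y@(m′ , n′) = begin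
      ⟦ x D.* y ⟧
        ≈⟨ reduce-≈ (m ℕ.* m′ ℕ.+ n ℕ.* n′) (m ℕ.* n′ ℕ.+ n ℕ.* m′) ⟩
      nat (m ℕ.* m′ ℕ.+ n ℕ.* n′) - nat (m ℕ.* n′ ℕ.+ n ℕ.* m′)
        ≈⟨ +-cong (nat-+* m m′ n n′) (trans (-‿cong (nat-+* m n′ n m′)) (sym (⁻¹-∙-comm _ _))) ⟩
      (nat m * nat m′ + nat n * nat n′) + (- (nat m * nat n′) + - (nat n * nat m′))
        ≈⟨ +-cong (+-congˡ negneg) (+-cong (-‿distribʳ-* _ _) (-‿distribˡ-* _ _)) ⟩
      (nat m * nat m′ + - nat n * - nat n′) + (nat m * - nat n′ + - nat n * nat m′)
        ≈⟨ solve 4 (λ a b c d → (a :* b :+ c :* d) :+ (a :* d :+ c :* b) := (a :+ c) :* (b :+ d))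
             refl (nat m) (nat m′) (- nat n) (- nat n′) ⟩
      (nat m - nat n) * (nat m′ - nat n′)
        ≈⟨ *-cong (⟦⟧≈ m n) (⟦⟧≈ m′ n′) ⟨
      ⟦ x ⟧ * ⟦ y ⟧ ∎
      where
      open Nat using (solve; _:=_; _:+_; _:*_)
      nat-+* : ∀ i j k l → nat (i ℕ.* j ℕ.+ k ℕ.* l) ≈ nat i * nat j + nat k * nat l
      nat-+* i j k l = trans (×-homo-+ 1# (i ℕ.* j) (k ℕ.* l)) (+-cong (×1-homo-* i j) (×1-homo-* k l))
      negneg : nat n * nat n′ ≈ - nat n * - nat n′
      negneg = begin
        nat n * nat n′          ≈⟨ -‿involutive _ ⟨
        - - (nat n * nat n′)    ≈⟨ -‿cong (-‿distribʳ-* _ _) ⟩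
        - (nat n * - nat n′)    ≈⟨ -‿distribˡ-* _ _ ⟩
        - nat n * - nat n′      ∎

    -‿homo : ∀ x → ⟦ D.- x ⟧ ≈ - ⟦ x ⟧
    -‿homo (m , n) = begin
      ⟦ n , m ⟧             ≈⟨ ⟦⟧≈ n m ⟩
      nat n - nat m         ≈⟨ +-comm _ _ ⟩
      - nat m + nat n       ≈⟨ +-congˡ (-‿involutive _) ⟨
      - nat m + - - nat n   ≈⟨ ⁻¹-∙-comm _ _ ⟩
      - (nat m - nat n)     ≈⟨ -‿cong (⟦⟧≈ m n) ⟨
      - ⟦ m , n ⟧           ∎

    morphism : Diff -Raw-AlmostCommutative⟶ fromCommutativeRing F
    morphism = record
      { ⟦_⟧ = ⟦_⟧ ; +-homo = +-homo ; *-homo = *-homo ; -‿homo = -‿homo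
      ; 0-homo = refl ; 1-homo = refl }

    _≟_ : ∀ x y → Maybe (⟦ x ⟧ ≈ ⟦ y ⟧)
    x ≟ y with ×.≡-dec ℕ._≟_ ℕ._≟_ x y
    ... | yes ≡.refl = just refl
    ... | no _       = nothing

  open Algebra.Solver.Ring Diff (fromCommutativeRing F) morphism _≟_ public
    using (Polynomial; solve; _:=_; _:+_; _:*_; _:-_; :-_; con)

  :1 : ∀ {n} → Polynomial n
  :1 = con (1 , 0)

  :0 : ∀ {n} → Polynomial n
  :0 = con (0 , 0)

-- Shifted factorials, finite sums and the operator (E - Q)(E - Q²)⋯(E - Qᵐ).

module QSeries {c ℓ} (F : CommutativeRing c ℓ) (Q : CommutativeRing.Carrier F) where
  open CommutativeRing F hiding (zero)
  open Algebra.Definitions.RawSemiring (Semiring.rawSemiring semiring) using (_^_; sum)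
  open Algebra.Properties.Semiring.Exp semiring using (^-homo-*)
  open RingSolver F
  open Relation.Binary.Reasoning.Setoid setoid

  ⟨_⟩_ : Carrier → ℕ → Carrier
  ⟨ y ⟩ zero  = 1#
  ⟨ y ⟩ suc m = ⟨ y ⟩ m * (1# - y * Q ^ m)

  infix 9 ⟨_⟩_

  ⟨⟩-cong : ∀ {y z} m → y ≈ z → ⟨ y ⟩ m ≈ ⟨ z ⟩ m
  ⟨⟩-cong zero    e = refl
  ⟨⟩-cong (suc m) e = *-cong (⟨⟩-cong m e) (+-congˡ (-‿cong (*-congʳ e)))

  ⟨⟩-+ : ∀ y m n → ⟨ y ⟩ (m ℕ.+ n) ≈ ⟨ y ⟩ m * ⟨ y * Q ^ m ⟩ n
  ⟨⟩-+ y m zero rewrite ℕ.+-identityʳ m = sym (*-identityʳ _)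
  ⟨⟩-+ y m (suc n) rewrite ℕ.+-suc m n = begin
    ⟨ y ⟩ (m ℕ.+ n) * (1# - y * Q ^ (m ℕ.+ n))
      ≈⟨ *-cong (⟨⟩-+ y m n) (+-congˡ (-‿cong (*-congˡ (^-homo-* Q m n)))) ⟩
    (⟨ y ⟩ m * ⟨ y * Q ^ m ⟩ n) * (1# - y * (Q ^ m * Q ^ n))
      ≈⟨ solve 5 (λ A B y s t → (A :* B) :* (:1 :- y :* (s :* t)) := A :* (B :* (:1 :- (y :* s) :* t)))
           refl (⟨ y ⟩ m) (⟨ y * Q ^ m ⟩ n) y (Q ^ m) (Q ^ n) ⟩
    ⟨ y ⟩ m * (⟨ y * Q ^ m ⟩ n * (1# - (y * Q ^ m) * Q ^ n)) ∎

  ⟨⟩-suc : ∀ y m → ⟨ y ⟩ suc m ≈ (1# - y) * ⟨ y * Q ⟩ m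
  ⟨⟩-suc y m = begin
    ⟨ y ⟩ suc m                       ≈⟨ ⟨⟩-+ y 1 m ⟩
    ⟨ y ⟩ 1 * ⟨ y * Q ^ 1 ⟩ m         ≈⟨ *-cong (solve 1 (λ y → :1 :* (:1 :- y :* :1) := :1 :- y) refl y)
                                           (⟨⟩-cong m (*-congˡ (*-identityʳ Q))) ⟩
    (1# - y) * ⟨ y * Q ⟩ m            ∎

  ⟨⟩-zero : ∀ y i m → y * Q ^ i ≈ 1# → i ℕ.< m → ⟨ y ⟩ m ≈ 0#
  ⟨⟩-zero y i (suc m) e i<1+m with i ℕ.≟ m
  ... | yes ≡.refl = trans (*-congˡ (trans (+-congˡ (-‿cong e)) (-‿inverseʳ 1#))) (zeroʳ _)
  ... | no i≢m     = trans (*-congʳ (⟨⟩-zero y i m e (ℕ.≤∧≢⇒< (ℕ.s≤s⁻¹ i<1+m) i≢m))) (zeroˡ _)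

  ∑< : ℕ → (ℕ → Carrier) → Carrier
  ∑< n f = sum {n} (λ k → f (toℕ k))

  ∑<-cong : ∀ n {f g} → (∀ k → f k ≈ g k) → ∑< n f ≈ ∑< n g
  ∑<-cong zero    e = refl
  ∑<-cong (suc n) e = +-cong (e 0) (∑<-cong n (λ k → e (suc k)))

  ∑<-suc : ∀ n (f : ℕ → Carrier) → ∑< (suc n) f ≈ ∑< n f + f n
  ∑<-suc zero    f = +-comm _ _
  ∑<-suc (suc n) f = trans (+-congˡ (∑<-suc n (λ k → f (suc k)))) (sym (+-assoc _ _ _))

  ∑<-* : ∀ n t f → ∑< n (λ k → t * f k) ≈ t * ∑< n f
  ∑<-* zero    t f = sym (zeroʳ t)
  ∑<-* (suc n) t f = trans (+-congˡ (∑<-* n t (λ k → f (suc k)))) (sym (distribˡ t _ _))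

  ∑<-sub : ∀ n t f g → ∑< n (λ k → f k - t * g k) ≈ ∑< n f - t * ∑< n g
  ∑<-sub zero    t f g = solve 1 (λ t → :0 := :0 :- t :* :0) refl t
  ∑<-sub (suc n) t f g = trans (+-congˡ (∑<-sub n t (λ k → f (suc k)) (λ k → g (suc k))))
    (solve 5 (λ f₀ t g₀ s s′ → f₀ :- t :* g₀ :+ (s :- t :* s′) := (f₀ :+ s) :- t :* (g₀ :+ s′))
      refl (f 0) t (g 0) (∑< n (λ k → f (suc k))) (∑< n (λ k → g (suc k))))

  -- One unit of shift trades the term `f 0`, zero by `lo`, for the term `f n`, zero by `hi`; the
  -- number of terms stays n.
  ∑<-shift : ∀ n s f → (∀ j → j ℕ.< s → f j ≈ 0#) → (∀ j → n ℕ.≤ j → f j ≈ 0#) →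
             ∑< n (λ k → f (k ℕ.+ s)) ≈ ∑< n f
  ∑<-shift n zero    f lo hi = ∑<-cong n (λ k → reflexive (≡.cong f (ℕ.+-identityʳ k)))
  ∑<-shift n (suc s) f lo hi = begin
    ∑< n (λ k → f (k ℕ.+ suc s))    ≈⟨ ∑<-cong n (λ k → reflexive (≡.cong f (ℕ.+-suc k s))) ⟩
    ∑< n (λ k → f (suc (k ℕ.+ s)))  ≈⟨ ∑<-shift n s (λ j → f (suc j)) (λ j j<s → lo (suc j) (ℕ.s≤s j<s))
                                         (λ j n≤j → hi (suc j) (ℕ.m≤n⇒m≤1+n n≤j)) ⟩
    ∑< n (λ j → f (suc j))          ≈⟨ +-identityˡ _ ⟨
    0# + ∑< n (λ j → f (suc j))     ≈⟨ +-congʳ (lo 0 (ℕ.s≤s ℕ.z≤n)) ⟨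
    ∑< (suc n) f                    ≈⟨ ∑<-suc n f ⟩
    ∑< n f + f n                    ≈⟨ +-congˡ (hi n ℕ.≤-refl) ⟩
    ∑< n f + 0#                     ≈⟨ +-identityʳ _ ⟩
    ∑< n f                          ∎

  -- δ m j is the coefficient of Eʲ in (E - Q)(E - Q²)⋯(E - Qᵐ).
  δ : ℕ → ℕ → Carrier
  δ zero    zero    = 1#
  δ zero    (suc j) = 0#
  δ (suc m) zero    = - Q ^ suc m * δ m zero
  δ (suc m) (suc j) = δ m j - Q ^ suc m * δ m (suc j)

  δ-vanishes : ∀ m j → m ℕ.< j → δ m j ≈ 0#
  δ-vanishes zero    (suc j) _   = refl
  δ-vanishes (suc m) (suc j) m<j = begin
    δ m j - Q ^ suc m * δ m (suc j)
      ≈⟨ +-cong (δ-vanishes m j (ℕ.s≤s⁻¹ m<j))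
           (-‿cong (*-congˡ (δ-vanishes m (suc j) (ℕ.m≤n⇒m≤1+n (ℕ.s≤s⁻¹ m<j))))) ⟩
    0# - Q ^ suc m * 0#  ≈⟨ solve 1 (λ t → :0 :- t :* :0 := :0) refl (Q ^ suc m) ⟩
    0#                   ∎

  -- The q-binomial theorem without division: for w = Q⁻ᵐ the coefficient of Eʲ is `δ m 0` (Q⁻ᵐ; Q)ⱼ
  -- / (Q; Q)ⱼ. Lowering m replaces w by wQ, which inverts the lower power of Q.
  δ-⟨⟩ : ∀ m j {w} → w * Q ^ m ≈ 1# → δ m j * ⟨ Q ⟩ j ≈ δ m 0 * ⟨ w ⟩ j
  δ-⟨⟩ m       zero    e = refl
  δ-⟨⟩ zero    (suc j) {w} e = trans (zeroˡ _)
    (sym (trans (*-congˡ (⟨⟩-zero w 0 (suc j) e (ℕ.s≤s ℕ.z≤n))) (zeroʳ _)))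
  δ-⟨⟩ (suc m) (suc j) {w} e = begin
    (δ m j - t * δ m (suc j)) * (⟨ Q ⟩ j * (1# - Q * x))
      ≈⟨ solve 6 (λ d d′ t p Q x → (d :- t :* d′) :* (p :* (:1 :- Q :* x))
           := (d :* p) :* (:1 :- Q :* x) :- t :* (d′ :* (p :* (:1 :- Q :* x))))
           refl (δ m j) (δ m (suc j)) t (⟨ Q ⟩ j) Q x ⟩
    (δ m j * ⟨ Q ⟩ j) * (1# - Q * x) - t * (δ m (suc j) * ⟨ Q ⟩ suc j)
      ≈⟨ +-cong (*-congʳ (δ-⟨⟩ m j e′)) (-‿cong (*-congˡ (δ-⟨⟩ m (suc j) e′))) ⟩
    (δ m 0 * p) * (1# - Q * x) - t * (δ m 0 * (p * (1# - (w * Q) * x)))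
      ≈⟨ solve 6 (λ d p t w Q x → (d :* p) :* (:1 :- Q :* x) :- t :* (d :* (p :* (:1 :- (w :* Q) :* x)))
           := (d :* p) :* ((:1 :- Q :* x :- t) :+ (w :* t) :* (Q :* x)))
           refl (δ m 0) p t w Q x ⟩
    (δ m 0 * p) * ((1# - Q * x - t) + (w * t) * (Q * x))
      ≈⟨ *-congˡ (+-congˡ (*-congʳ e)) ⟩
    (δ m 0 * p) * ((1# - Q * x - t) + 1# * (Q * x))
      ≈⟨ solve 5 (λ d p t Q x → (d :* p) :* ((:1 :- Q :* x :- t) :+ :1 :* (Q :* x))
           := (d :* p) :* (:1 :- t)) refl (δ m 0) p t Q x ⟩
    (δ m 0 * p) * (1# - t)
      -- Writing 1 as `w * t` turns `1# - t` into `- t * - (w - 1)` up to order: the factor `- t`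
      -- completes `δ (suc m) 0`, and `1# - w` is the missing first factor of `⟨ w ⟩ suc j`.
      ≈⟨ *-congˡ (+-congʳ e) ⟨
    (δ m 0 * p) * (w * t - t)
      ≈⟨ solve 4 (λ d p t w → (d :* p) :* (w :* t :- t) := (:- t :* d) :* ((:1 :- w) :* p))
           refl (δ m 0) p t w ⟩
    (- t * δ m 0) * ((1# - w) * p)
      ≈⟨ *-congˡ (⟨⟩-suc w j) ⟨
    (- t * δ m 0) * ⟨ w ⟩ suc j ∎
    where
    t = Q ^ suc m
    x = Q ^ j
    p = ⟨ w * Q ⟩ j
    e′ : (w * Q) * Q ^ m ≈ 1#
    e′ = trans (*-assoc _ _ _) e

  -- The recursion for `δ` multiplies the operator by `E - Q ^ suc m`; summation by parts applies
  -- this factor to the sequence `g` instead. The two sums get the same length because `δ m (suc m)`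
  -- vanishes.
  ∑δ-suc : ∀ m (g : ℕ → Carrier) → ∑< (suc (suc m)) (λ j → δ (suc m) j * g j)
                   ≈ ∑< (suc m) (λ j → δ m j * (g (suc j) - Q ^ suc m * g j))
  ∑δ-suc m g = begin
    (- t * δ m 0) * g 0 + ∑< (suc m) (λ j → (δ m j - t * δ m (suc j)) * g (suc j))
      ≈⟨ +-congˡ (∑<-cong (suc m) λ j →
           solve 4 (λ d t d′ g → (d :- t :* d′) :* g := d :* g :- t :* (d′ :* g))
             refl (δ m j) t (δ m (suc j)) (g (suc j))) ⟩
    (- t * δ m 0) * g 0 + ∑< (suc m) (λ j → δ m j * g (suc j) - t * (δ m (suc j) * g (suc j)))
      ≈⟨ +-congˡ (∑<-sub (suc m) t (λ j → δ m j * g (suc j)) (λ j → δ m (suc j) * g (suc j))) ⟩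
    (- t * δ m 0) * g 0 + (S - t * ∑< (suc m) (λ j → δ m (suc j) * g (suc j)))
      ≈⟨ solve 5 (λ t d g S S′ → (:- t :* d) :* g :+ (S :- t :* S′) := S :- t :* (d :* g :+ S′))
           refl t (δ m 0) (g 0) S (∑< (suc m) (λ j → δ m (suc j) * g (suc j))) ⟩
    S - t * ∑< (suc (suc m)) (λ j → δ m j * g j)
      ≈⟨ +-congˡ (-‿cong (*-congˡ (trans (∑<-suc (suc m) (λ j → δ m j * g j))
           (trans (+-congˡ (trans (*-congʳ (δ-vanishes m (suc m) ℕ.≤-refl)) (zeroˡ _))) (+-identityʳ _))))) ⟩
    S - t * ∑< (suc m) (λ j → δ m j * g j)
      ≈⟨ ∑<-sub (suc m) t (λ j → δ m j * g (suc j)) (λ j → δ m j * g j) ⟨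
    ∑< (suc m) (λ j → δ m j * g (suc j) - t * (δ m j * g j))
      ≈⟨ ∑<-cong (suc m) (λ j →
           solve 4 (λ d g′ t g → d :* g′ :- t :* (d :* g) := d :* (g′ :- t :* g))
             refl (δ m j) (g (suc j)) t (g j)) ⟩
    ∑< (suc m) (λ j → δ m j * (g (suc j) - t * g j)) ∎
    where
    t = Q ^ suc m
    S = ∑< (suc m) (λ j → δ m j * g (suc j))

  -- The factor E - Qᵐ⁺¹ maps (y; Q)ₘ₊₁ to (1 - Qᵐ⁺¹) (yQ; Q)ₘ, where E : y ↦ yQ.
  ∑δ⟨⟩ : ∀ m y → ∑< (suc m) (λ j → δ m j * ⟨ y * Q ^ j ⟩ m) ≈ ⟨ Q ⟩ m
  ∑δ⟨⟩ zero    y = trans (+-identityʳ _) (*-identityʳ _)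
  ∑δ⟨⟩ (suc m) y = begin
    ∑< (suc (suc m)) (λ j → δ (suc m) j * ⟨ y * Q ^ j ⟩ suc m)
      ≈⟨ ∑δ-suc m (λ j → ⟨ y * Q ^ j ⟩ suc m) ⟩
    ∑< (suc m) (λ j → δ m j * (⟨ y * Q ^ suc j ⟩ suc m - t * ⟨ y * Q ^ j ⟩ suc m))
      ≈⟨ ∑<-cong (suc m) step ⟩
    ∑< (suc m) (λ j → (1# - t) * (δ m j * ⟨ (y * Q) * Q ^ j ⟩ m))
      ≈⟨ ∑<-* (suc m) (1# - t) (λ j → δ m j * ⟨ (y * Q) * Q ^ j ⟩ m) ⟩
    (1# - t) * ∑< (suc m) (λ j → δ m j * ⟨ (y * Q) * Q ^ j ⟩ m)
      ≈⟨ *-congˡ (∑δ⟨⟩ m (y * Q)) ⟩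
    (1# - t) * ⟨ Q ⟩ m
      ≈⟨ *-comm _ _ ⟩
    ⟨ Q ⟩ m * (1# - t) ∎
    where
    t = Q ^ suc m
    step : ∀ j → δ m j * (⟨ y * Q ^ suc j ⟩ suc m - t * ⟨ y * Q ^ j ⟩ suc m)
               ≈ (1# - t) * (δ m j * ⟨ (y * Q) * Q ^ j ⟩ m)
    step j = begin
      δ m j * (⟨ y * Q ^ suc j ⟩ m * (1# - (y * Q ^ suc j) * Q ^ m) - t * ⟨ y * Q ^ j ⟩ suc m)
        -- The first factorial gives up its last factor and the second its first, which leaves the
        -- same `p` in both. The rest is (1 - yQʲ⁺ᵐ⁺¹) - Qᵐ⁺¹(1 - yQʲ) = 1 - Qᵐ⁺¹.
        ≈⟨ *-congˡ (+-cong (*-congʳ (⟨⟩-cong m (sym (*-assoc y Q (Q ^ j)))))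
             (-‿cong (*-congˡ (trans (⟨⟩-suc (y * Q ^ j) m) (*-congˡ (⟨⟩-cong m
               (solve 3 (λ y x Q → (y :* x) :* Q := (y :* Q) :* x) refl y (Q ^ j) Q))))))) ⟩
      δ m j * (p * (1# - (y * (Q * Q ^ j)) * Q ^ m) - (Q * Q ^ m) * ((1# - y * Q ^ j) * p))
        ≈⟨ solve 6 (λ d p y Q x t →
             d :* (p :* (:1 :- (y :* (Q :* x)) :* t) :- (Q :* t) :* ((:1 :- y :* x) :* p))
             := (:1 :- Q :* t) :* (d :* p)) refl (δ m j) p y Q (Q ^ j) (Q ^ m) ⟩
      (1# - t) * (δ m j * p) ∎
      where p = ⟨ (y * Q) * Q ^ j ⟩ m

  -- The two specialised sums, with `r k` in the role of 1/(Q; Q)ₖ.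

  module Evaluation (r : ℕ → Carrier) (⟨Q⟩r≈1 : ∀ k → ⟨ Q ⟩ k * r k ≈ 1#) where

    -- Both sides are the Gaussian binomial coefficient of m + j over m.
    ⟨⟩r-symm : ∀ m j → ⟨ Q ^ suc m ⟩ j * r j ≈ ⟨ Q ^ suc j ⟩ m * r m
    ⟨⟩r-symm m j = begin
      B * r j                                ≈⟨ solve 2 (λ B r → B :* r := :1 :* (B :* r)) refl B (r j) ⟩
      1# * (B * r j)                         ≈⟨ *-congʳ (⟨Q⟩r≈1 m) ⟨
      (⟨ Q ⟩ m * r m) * (B * r j)            ≈⟨ solve 4 (λ A a B b → (A :* a) :* (B :* b) := (A :* B) :* (a :* b))
                                                  refl (⟨ Q ⟩ m) (r m) B (r j) ⟩
      (⟨ Q ⟩ m * B) * (r m * r j)            ≈⟨ *-congʳ (⟨⟩-+ Q m j) ⟨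
      ⟨ Q ⟩ (m ℕ.+ j) * (r m * r j)          ≡⟨ ≡.cong (λ i → ⟨ Q ⟩ i * (r m * r j)) (ℕ.+-comm m j) ⟩
      ⟨ Q ⟩ (j ℕ.+ m) * (r m * r j)          ≈⟨ *-congʳ (⟨⟩-+ Q j m) ⟩
      (⟨ Q ⟩ j * B′) * (r m * r j)           ≈⟨ solve 4 (λ A a B b → (A :* B) :* (b :* a) := (A :* a) :* (B :* b))
                                                  refl (⟨ Q ⟩ j) (r j) B′ (r m) ⟩
      (⟨ Q ⟩ j * r j) * (B′ * r m)           ≈⟨ *-congʳ (⟨Q⟩r≈1 j) ⟩
      1# * (B′ * r m)                        ≈⟨ *-identityˡ _ ⟩
      B′ * r m                               ∎
      where
      B  = ⟨ Q ^ suc m ⟩ j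
      B′ = ⟨ Q ^ suc j ⟩ m

    -- The factorial in w turns into an operator coefficient, and the symmetry of the Gaussian
    -- binomial turns the other one into a factorial of fixed length m, as `∑δ⟨⟩` requires. The
    -- indices are independent because the two specialisations use (k, k + s) and (k + s, k).
    δ-⟨⟩-⟨⟩ : ∀ m i j {w} → w * Q ^ m ≈ 1# →
      δ m 0 * ((⟨ w ⟩ i * ⟨ Q ^ suc m ⟩ j) * (r i * r j)) ≈ r m * (δ m i * ⟨ Q ^ suc j ⟩ m)
    δ-⟨⟩-⟨⟩ m i j {w} e = begin
      δ m 0 * ((⟨ w ⟩ i * ⟨ Q ^ suc m ⟩ j) * (r i * r j))
        ≈⟨ solve 5 (λ d A B a b → d :* ((A :* B) :* (a :* b)) := ((d :* A) :* a) :* (B :* b))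
             refl (δ m 0) (⟨ w ⟩ i) (⟨ Q ^ suc m ⟩ j) (r i) (r j) ⟩
      ((δ m 0 * ⟨ w ⟩ i) * r i) * (⟨ Q ^ suc m ⟩ j * r j)
        ≈⟨ *-cong (*-congʳ (sym (δ-⟨⟩ m i e))) (⟨⟩r-symm m j) ⟩
      ((δ m i * ⟨ Q ⟩ i) * r i) * (⟨ Q ^ suc j ⟩ m * r m)
        ≈⟨ *-congʳ (trans (*-assoc _ _ _) (trans (*-congˡ (⟨Q⟩r≈1 i)) (*-identityʳ _))) ⟩
      δ m i * (⟨ Q ^ suc j ⟩ m * r m)
        ≈⟨ solve 3 (λ d B b → d :* (B :* b) := b :* (d :* B)) refl (δ m i) (⟨ Q ^ suc j ⟩ m) (r m) ⟩
      r m * (δ m i * ⟨ Q ^ suc j ⟩ m) ∎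

    -- The shift enters only through Q^{1 + k + s} = Q^{1 + s} Qᵏ, so this is `∑δ⟨⟩` at y = Q^{1 +
    -- s}.
    ∑⟨Q⁻ᵐ⟩⟨Qᵐ⁺¹⟩ : ∀ m s {w} → w * Q ^ m ≈ 1# →
      δ m 0 * ∑< (suc m) (λ k → (⟨ w ⟩ k * ⟨ Q ^ suc m ⟩ (k ℕ.+ s)) * (r k * r (k ℕ.+ s))) ≈ 1#
    ∑⟨Q⁻ᵐ⟩⟨Qᵐ⁺¹⟩ m s {w} e = begin
      δ m 0 * ∑< (suc m) f
        ≈⟨ ∑<-* (suc m) (δ m 0) f ⟨
      ∑< (suc m) (λ k → δ m 0 * f k)
        ≈⟨ ∑<-cong (suc m) (λ k → trans (δ-⟨⟩-⟨⟩ m k (k ℕ.+ s) e)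
             (*-congˡ (*-congˡ (⟨⟩-cong m (exponent k))))) ⟩
      ∑< (suc m) (λ k → r m * (δ m k * ⟨ Q ^ suc s * Q ^ k ⟩ m))
        ≈⟨ ∑<-* (suc m) (r m) (λ k → δ m k * ⟨ Q ^ suc s * Q ^ k ⟩ m) ⟩
      r m * ∑< (suc m) (λ k → δ m k * ⟨ Q ^ suc s * Q ^ k ⟩ m)
        ≈⟨ *-congˡ (∑δ⟨⟩ m (Q ^ suc s)) ⟩
      r m * ⟨ Q ⟩ m
        ≈⟨ trans (*-comm _ _) (⟨Q⟩r≈1 m) ⟩
      1# ∎
      where
      f : ℕ → Carrier
      f k = (⟨ w ⟩ k * ⟨ Q ^ suc m ⟩ (k ℕ.+ s)) * (r k * r (k ℕ.+ s))
      exponent : ∀ k → Q ^ suc (k ℕ.+ s) ≈ Q ^ suc s * Q ^ k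
      exponent k = trans (reflexive (≡.cong (λ i → Q ^ suc i) (ℕ.+-comm k s))) (^-homo-* Q (suc s) k)

    -- Here the summand is extended to all j = k + s: it vanishes for j < s
    -- because of the factor (Q^{1 - s + j}; Q)ₘ, and for j > m because of δ.
    ∑⟨Qᵐ⁺¹⟩⟨Q⁻ᵐ⟩ : ∀ m s {w} → s ℕ.≤ m → w * Q ^ m ≈ 1# →
      δ m 0 * ∑< (suc m) (λ k → (⟨ Q ^ suc m ⟩ k * ⟨ w ⟩ (k ℕ.+ s)) * (r k * r (k ℕ.+ s))) ≈ 1#
    ∑⟨Qᵐ⁺¹⟩⟨Q⁻ᵐ⟩ m s {w} s≤m e = begin
      δ m 0 * ∑< (suc m) f
        ≈⟨ ∑<-* (suc m) (δ m 0) f ⟨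
      ∑< (suc m) (λ k → δ m 0 * f k)
        ≈⟨ ∑<-cong (suc m) (λ k → trans (*-congˡ (*-cong (*-comm _ _) (*-comm _ _)))
             (trans (δ-⟨⟩-⟨⟩ m (k ℕ.+ s) k e)
             (*-congˡ (*-congˡ (⟨⟩-cong m (sym (exponent k))))))) ⟩
      ∑< (suc m) (λ k → r m * h (k ℕ.+ s))
        ≈⟨ ∑<-* (suc m) (r m) (λ k → h (k ℕ.+ s)) ⟩
      r m * ∑< (suc m) (λ k → h (k ℕ.+ s))
        ≈⟨ *-congˡ (∑<-shift (suc m) s h h-lo
             (λ j m<j → trans (*-congʳ (δ-vanishes m j m<j)) (zeroˡ _))) ⟩
      r m * ∑< (suc m) h
        ≈⟨ *-congˡ (∑δ⟨⟩ m (Q * v)) ⟩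
      r m * ⟨ Q ⟩ m
        ≈⟨ trans (*-comm _ _) (⟨Q⟩r≈1 m) ⟩
      1# ∎
      where
      f : ℕ → Carrier
      f k = (⟨ Q ^ suc m ⟩ k * ⟨ w ⟩ (k ℕ.+ s)) * (r k * r (k ℕ.+ s))
      -- `v` stands for Q⁻ˢ: only an inverse `w` of Qᵐ is given, and `s≤m` allows it to be lowered
      -- to one of Qˢ.
      v = w * Q ^ (m ℕ.∸ s)
      vQˢ≈1 : v * Q ^ s ≈ 1#
      vQˢ≈1 = begin
        (w * Q ^ (m ℕ.∸ s)) * Q ^ s    ≈⟨ *-assoc _ _ _ ⟩
        w * (Q ^ (m ℕ.∸ s) * Q ^ s)    ≈⟨ *-congˡ (^-homo-* Q (m ℕ.∸ s) s) ⟨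
        w * Q ^ (m ℕ.∸ s ℕ.+ s)        ≡⟨ ≡.cong (λ i → w * Q ^ i) (ℕ.m∸n+n≡m s≤m) ⟩
        w * Q ^ m                      ≈⟨ e ⟩
        1#                             ∎
      h : ℕ → Carrier
      h j = δ m j * ⟨ (Q * v) * Q ^ j ⟩ m
      exponent : ∀ k → (Q * v) * Q ^ (k ℕ.+ s) ≈ Q ^ suc k
      exponent k = begin
        (Q * v) * Q ^ (k ℕ.+ s)       ≈⟨ *-congˡ (^-homo-* Q k s) ⟩
        (Q * v) * (Q ^ k * Q ^ s)     ≈⟨ solve 4 (λ Q v x y → (Q :* v) :* (x :* y) := (Q :* x) :* (v :* y))
                                           refl Q v (Q ^ k) (Q ^ s) ⟩
        Q ^ suc k * (v * Q ^ s)       ≈⟨ *-congˡ vQˢ≈1 ⟩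
        Q ^ suc k * 1#                ≈⟨ *-identityʳ _ ⟩
        Q ^ suc k                     ∎
      h-lo : ∀ j → j ℕ.< s → h j ≈ 0#
      h-lo j j<s = trans (*-congˡ (⟨⟩-zero _ i m (begin
          ((Q * v) * Q ^ j) * Q ^ i    ≈⟨ solve 4 (λ Q v x y → ((Q :* v) :* x) :* y := v :* ((Q :* x) :* y))
                                            refl Q v (Q ^ j) (Q ^ i) ⟩
          v * (Q ^ suc j * Q ^ i)      ≈⟨ *-congˡ (^-homo-* Q (suc j) i) ⟨
          v * Q ^ (suc j ℕ.+ i)        ≡⟨ ≡.cong (λ k → v * Q ^ k) (ℕ.m+[n∸m]≡n j<s) ⟩
          v * Q ^ s                    ≈⟨ vQˢ≈1 ⟩
          1#                           ∎) i<m)) (zeroʳ _)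
        where
        -- The factor of index s - 1 - j in (Q^{1 - s + j}; Q)ₘ is 1 - Q⁰, and s ≤ m puts it among
        -- the m factors.
        i = s ℕ.∸ suc j
        i<m : i ℕ.< m
        i<m = ℕ.<-≤-trans (ℕ.∸-monoʳ-< (ℕ.s≤s ℕ.z≤n) j<s) s≤m

-- Congruences with quotient in a subring.

record Subring {c ℓ} (F : CommutativeRing c ℓ) r : Set (c ⊔ ℓ ⊔ lsuc r) where
  open CommutativeRing F
  field
    _∈S    : Carrier → Set r
    ∈-resp : ∀ {x y} → x ≈ y → x ∈S → y ∈S
    1∈     : 1# ∈S
    +-∈    : ∀ {x y} → x ∈S → y ∈S → (x + y) ∈S
    *-∈    : ∀ {x y} → x ∈S → y ∈S → (x * y) ∈S
    -‿∈    : ∀ {x} → x ∈S → (- x) ∈S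

module Congruence {c ℓ r} {F : CommutativeRing c ℓ} (S : Subring F r) where
  open CommutativeRing F hiding (zero)
  open Subring S
  open Algebra.Definitions.RawSemiring (Semiring.rawSemiring semiring) using (_^_)
  open RingSolver F
  open Relation.Binary.Reasoning.Setoid setoid

  infix 4 _~_[_]
  -- Both sides carry their membership because the quotient of a product of congruences, in `~-*`,
  -- involves one side of each.
  record _~_[_] (x y p : Carrier) : Set (c ⊔ ℓ ⊔ r) where
    constructor mk~
    field
      left∈     : x ∈S
      right∈    : y ∈S
      quotient  : Carrier
      quotient∈ : quotient ∈S
      equation  : x - y ≈ p * quotient
  open _~_[_] public

  0∈ : 0# ∈S
  0∈ = ∈-resp (-‿inverseʳ 1#) (+-∈ 1∈ (-‿∈ 1∈))

  ^-∈ : ∀ {x} m → x ∈S → (x ^ m) ∈S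
  ^-∈ zero    x∈ = 1∈
  ^-∈ (suc m) x∈ = *-∈ x∈ (^-∈ m x∈)

  ~-refl : ∀ {p x} → x ∈S → x ~ x [ p ]
  ~-refl {p} {x} x∈ = mk~ x∈ x∈ 0# 0∈ (trans (-‿inverseʳ x) (sym (zeroʳ p)))

  ~-respʳ : ∀ {p x y z} → y ≈ z → x ~ y [ p ] → x ~ z [ p ]
  ~-respʳ y≈z (mk~ x∈ y∈ d d∈ e) =
    mk~ x∈ (∈-resp y≈z y∈) d d∈ (trans (+-congˡ (-‿cong (sym y≈z))) e)

  ~-+ : ∀ {p x y x′ y′} → x ~ y [ p ] → x′ ~ y′ [ p ] → x + x′ ~ y + y′ [ p ]
  ~-+ {p} {x} {y} {x′} {y′} (mk~ x∈ y∈ d d∈ e) (mk~ x′∈ y′∈ d′ d′∈ e′) =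
    mk~ (+-∈ x∈ x′∈) (+-∈ y∈ y′∈) (d + d′) (+-∈ d∈ d′∈) (begin
      (x + x′) - (y + y′)    ≈⟨ solve 4 (λ x x′ y y′ → (x :+ x′) :- (y :+ y′) := (x :- y) :+ (x′ :- y′))
                                  refl x x′ y y′ ⟩
      (x - y) + (x′ - y′)    ≈⟨ +-cong e e′ ⟩
      p * d + p * d′         ≈⟨ distribˡ p d d′ ⟨
      p * (d + d′)           ∎)

  ~-* : ∀ {p x y x′ y′} → x ~ y [ p ] → x′ ~ y′ [ p ] → x * x′ ~ y * y′ [ p ]
  ~-* {p} {x} {y} {x′} {y′} (mk~ x∈ y∈ d d∈ e) (mk~ x′∈ y′∈ d′ d′∈ e′) =
    mk~ (*-∈ x∈ x′∈) (*-∈ y∈ y′∈) (d * x′ + y * d′) (+-∈ (*-∈ d∈ x′∈) (*-∈ y∈ d′∈)) (begin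
      x * x′ - y * y′                ≈⟨ solve 4 (λ x x′ y y′ → x :* x′ :- y :* y′ := (x :- y) :* x′ :+ y :* (x′ :- y′))
                                          refl x x′ y y′ ⟩
      (x - y) * x′ + y * (x′ - y′)   ≈⟨ +-cong (*-congʳ e) (*-congˡ e′) ⟩
      (p * d) * x′ + y * (p * d′)    ≈⟨ solve 5 (λ p d x′ y d′ → (p :* d) :* x′ :+ y :* (p :* d′)
                                          := p :* (d :* x′ :+ y :* d′)) refl p d x′ y d′ ⟩
      p * (d * x′ + y * d′)          ∎)

  ~-neg : ∀ {p x y} → x ~ y [ p ] → - x ~ - y [ p ]
  ~-neg {p} {x} {y} (mk~ x∈ y∈ d d∈ e) = mk~ (-‿∈ x∈) (-‿∈ y∈) (- d) (-‿∈ d∈) (begin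
    - x - - y    ≈⟨ solve 2 (λ x y → :- x :- :- y := :- (x :- y)) refl x y ⟩
    - (x - y)    ≈⟨ -‿cong e ⟩
    - (p * d)    ≈⟨ solve 2 (λ p d → :- (p :* d) := p :* :- d) refl p d ⟩
    p * - d      ∎)

-- Uniqueness of inverses, and the constant term `δ m 0` in terms of q.

module Units {c ℓ} (F : CommutativeRing c ℓ) where
  open CommutativeRing F
  open RingSolver F
  open Relation.Binary.Reasoning.Setoid setoid

  inverse-unique : ∀ {x y z} → x * y ≈ 1# → x * z ≈ 1# → y ≈ z
  inverse-unique {x} {y} {z} e e′ = begin
    y              ≈⟨ *-identityʳ y ⟨
    y * 1#         ≈⟨ *-congˡ e′ ⟨
    y * (x * z)    ≈⟨ solve 3 (λ x y z → y :* (x :* z) := (x :* y) :* z) refl x y z ⟩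
    (x * y) * z    ≈⟨ *-congʳ e ⟩
    1# * z         ≈⟨ *-identityˡ z ⟩
    z              ∎

module SquareBase {c ℓ} (F : CommutativeRing c ℓ) (q : CommutativeRing.Carrier F) where
  open CommutativeRing F
  open Algebra.Definitions.RawSemiring (Semiring.rawSemiring semiring) using (_^_)
  open Algebra.Properties.Semiring.Exp semiring using (^-homo-*; ^-assocʳ)
  open RingSolver F
  open Relation.Binary.Reasoning.Setoid setoid

  Q : Carrier
  Q = q ^ 2

  open QSeries F Q

  -- The constant term is the product of the -Qⁱ for 1 ≤ i ≤ m, and Q = q² removes the half from the
  -- exponent m(m + 1)/2.
  δ₀≈ : ∀ m → δ m 0 ≈ (- 1#) ^ m * q ^ (m ℕ.* suc m)
  δ₀≈ ℕ.zero  = sym (*-identityʳ 1#)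
  δ₀≈ (suc m) = begin
    - Q ^ suc m * δ m 0
      ≈⟨ *-cong (-‿cong (^-assocʳ q 2 (suc m))) (δ₀≈ m) ⟩
    - q ^ (2 ℕ.* suc m) * ((- 1#) ^ m * q ^ (m ℕ.* suc m))
      ≈⟨ solve 3 (λ x σ y → :- x :* (σ :* y) := (:- :1 :* σ) :* (x :* y))
           refl (q ^ (2 ℕ.* suc m)) ((- 1#) ^ m) (q ^ (m ℕ.* suc m)) ⟩
    (- 1#) ^ suc m * (q ^ (2 ℕ.* suc m) * q ^ (m ℕ.* suc m))
      ≈⟨ *-congˡ (^-homo-* q (2 ℕ.* suc m) (m ℕ.* suc m)) ⟨
    (- 1#) ^ suc m * q ^ (2 ℕ.* suc m ℕ.+ m ℕ.* suc m)
      ≡⟨ ≡.cong (λ k → (- 1#) ^ suc m * q ^ k)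
           (≡.trans (≡.sym (ℕ.*-distribʳ-+ (suc m) 2 m)) (ℕ.*-comm (2 ℕ.+ m) (suc m))) ⟩
    (- 1#) ^ suc m * q ^ (suc m ℕ.* suc (suc m)) ∎

  -- With y a negative power of q this identifies the right side of the theorem as the inverse of
  -- `δ m 0`; the sign (-1)ᵐ is its own inverse.
  δ₀-inverse : ∀ m {y} → q ^ (m ℕ.* suc m) * y ≈ 1# → δ m 0 * ((- 1#) ^ m * y) ≈ 1#
  δ₀-inverse m {y} e = begin
    δ m 0 * (σ m * y)                          ≈⟨ *-congʳ (δ₀≈ m) ⟩
    (σ m * q ^ (m ℕ.* suc m)) * (σ m * y)      ≈⟨ solve 3 (λ σ x y → (σ :* x) :* (σ :* y) := (σ :* σ) :* (x :* y))
                                                    refl (σ m) (q ^ (m ℕ.* suc m)) y ⟩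
    (σ m * σ m) * (q ^ (m ℕ.* suc m) * y)      ≈⟨ *-cong (σσ≈1 m) e ⟩
    1# * 1#                                    ≈⟨ *-identityʳ 1# ⟩
    1#                                         ∎
    where
    σ : ℕ → Carrier
    σ k = (- 1#) ^ k
    σσ≈1 : ∀ k → σ k * σ k ≈ 1#
    σσ≈1 ℕ.zero  = *-identityʳ 1#
    σσ≈1 (suc k) = trans (solve 1 (λ σ → (:- :1 :* σ) :* (:- :1 :* σ) := σ :* σ) refl (σ k)) (σσ≈1 k)

  q^odd≈ : ∀ m → q ^ suc (2 ℕ.* m) ≈ q * Q ^ m
  q^odd≈ m = *-congˡ (sym (^-assocʳ q 2 m))

  [q^odd]²≈ : ∀ m → (q * Q ^ m) * (q * Q ^ m) ≈ Q * Q ^ (m ℕ.+ m)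
  [q^odd]²≈ m = trans
    (solve 2 (λ q x → (q :* x) :* (q :* x) := (q :* (q :* :1)) :* (x :* x)) refl q (Q ^ m))
    (*-congˡ (sym (^-homo-* Q m m)))

-- Replacing a by u⁻¹ and by u, and combining the two congruences.

module Specialisation {c ℓ r} {F : CommutativeRing c ℓ} (S : Subring F r) (q : CommutativeRing.Carrier F) where
  open CommutativeRing F
  open Algebra.Definitions.RawSemiring (Semiring.rawSemiring semiring) using (_^_)
  open RingSolver F
  open Relation.Binary.Reasoning.Setoid setoid
  open Subring S
  open Congruence S
  open Units F
  open SquareBase F q using (Q)
  open QSeries F Q

  module Sum
    (a a⁻¹ q⁻¹ : Carrier) (ρ : ℕ → Carrier)
    (a∈ : a ∈S) (a⁻¹∈ : a⁻¹ ∈S) (q∈ : q ∈S) (q⁻¹∈ : q⁻¹ ∈S) (ρ∈ : ∀ k → ρ k ∈S)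
    (aa⁻¹≈1 : a * a⁻¹ ≈ 1#) (qq⁻¹≈1 : q * q⁻¹ ≈ 1#) (⟨Q⟩ρ≈1 : ∀ k → ⟨ Q ⟩ k * ρ k ≈ 1#)
    where

    open Evaluation ρ ⟨Q⟩ρ≈1

    ⟨⟩-~ : ∀ {p x y} m → x ~ y [ p ] → ⟨ x ⟩ m ~ ⟨ y ⟩ m [ p ]
    ⟨⟩-~ ℕ.zero  e = ~-refl 1∈
    ⟨⟩-~ (suc m) e = ~-* (⟨⟩-~ m e) (~-+ (~-refl 1∈) (~-neg (~-* e (~-refl (^-∈ m (^-∈ 2 q∈))))))

    ∑<-~ : ∀ {p} n {f g : ℕ → Carrier} → (∀ k → f k ~ g k [ p ]) → ∑< n f ~ ∑< n g [ p ]
    ∑<-~ ℕ.zero  e = ~-refl 0∈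
    ∑<-~ (suc n) e = ~-+ (e 0) (∑<-~ n (λ k → e (suc k)))

    term : ℕ → Carrier → Carrier → ℕ → Carrier
    term s x y k = (⟨ x ⟩ k * ⟨ y ⟩ (k ℕ.+ s)) * (ρ k * ρ (k ℕ.+ s))

    ∑term-~ : ∀ {p x x′ y y′} n s → x ~ x′ [ p ] → y ~ y′ [ p ] →
              ∑< n (term s x y) ~ ∑< n (term s x′ y′) [ p ]
    ∑term-~ n s e e′ = ∑<-~ n λ k →
      ~-* (~-* (⟨⟩-~ k e) (⟨⟩-~ (k ℕ.+ s) e′)) (~-refl (*-∈ (ρ∈ k) (ρ∈ (k ℕ.+ s))))

    module _ (m s : ℕ) (s≤m : s ℕ.≤ m) {B : Carrier} (δB≈1 : δ m 0 * B ≈ 1#) where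

      -- For n = 2m + 1 these are qⁿ, Q⁻ᵐ and q⁻ⁿ; `v` is the `w` of the evaluations.
      u v u⁻¹ : Carrier
      u = q * Q ^ m
      v = (q⁻¹ * q⁻¹) ^ m
      u⁻¹ = q⁻¹ * v

      private
        Qᵏvᵏ≈1 : ∀ k → Q ^ k * (q⁻¹ * q⁻¹) ^ k ≈ 1#
        Qᵏvᵏ≈1 ℕ.zero  = *-identityʳ 1#
        Qᵏvᵏ≈1 (suc k) = begin
          ((q * (q * 1#)) * Q ^ k) * ((q⁻¹ * q⁻¹) * (q⁻¹ * q⁻¹) ^ k)
            ≈⟨ solve 4 (λ q p x y → ((q :* (q :* :1)) :* x) :* ((p :* p) :* y)
                 := ((q :* p) :* (q :* p)) :* (x :* y)) refl q q⁻¹ (Q ^ k) ((q⁻¹ * q⁻¹) ^ k) ⟩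
          ((q * q⁻¹) * (q * q⁻¹)) * (Q ^ k * (q⁻¹ * q⁻¹) ^ k)
            ≈⟨ *-cong (*-cong qq⁻¹≈1 qq⁻¹≈1) (Qᵏvᵏ≈1 k) ⟩
          (1# * 1#) * 1#
            ≈⟨ solve 0 ((:1 :* :1) :* :1 := :1) refl ⟩
          1# ∎

        vQᵐ≈1 : v * Q ^ m ≈ 1#
        vQᵐ≈1 = trans (*-comm _ _) (Qᵏvᵏ≈1 m)

        uu⁻¹≈1 : u * u⁻¹ ≈ 1#
        uu⁻¹≈1 = begin
          (q * Q ^ m) * (q⁻¹ * v)    ≈⟨ solve 4 (λ q x p v → (q :* x) :* (p :* v) := (q :* p) :* (x :* v))
                                          refl q (Q ^ m) q⁻¹ v ⟩
          (q * q⁻¹) * (Q ^ m * v)    ≈⟨ *-cong qq⁻¹≈1 (Qᵏvᵏ≈1 m) ⟩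
          1# * 1#                    ≈⟨ *-identityʳ 1# ⟩
          1#                         ∎

        u⁻¹q≈v : u⁻¹ * q ≈ v
        u⁻¹q≈v = begin
          (q⁻¹ * v) * q    ≈⟨ solve 3 (λ p v q → (p :* v) :* q := (q :* p) :* v) refl q⁻¹ v q ⟩
          (q * q⁻¹) * v    ≈⟨ *-congʳ qq⁻¹≈1 ⟩
          1# * v           ≈⟨ *-identityˡ v ⟩
          v                ∎

        uq≈Qᵐ⁺¹ : u * q ≈ Q ^ suc m
        uq≈Qᵐ⁺¹ = solve 2 (λ q x → (q :* x) :* q := (q :* (q :* :1)) :* x) refl q (Q ^ m)

        u∈ : u ∈S
        u∈ = *-∈ q∈ (^-∈ m (^-∈ 2 q∈))

        u⁻¹∈ : u⁻¹ ∈S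
        u⁻¹∈ = *-∈ q⁻¹∈ (^-∈ m (*-∈ q⁻¹∈ q⁻¹∈))

        a~u⁻¹ : a ~ u⁻¹ [ 1# - a * u ]
        a~u⁻¹ = mk~ a∈ u⁻¹∈ (- u⁻¹) (-‿∈ u⁻¹∈) (begin
          a - u⁻¹                  ≈⟨ solve 2 (λ a y → a :- y := a :* :1 :- y) refl a u⁻¹ ⟩
          a * 1# - u⁻¹             ≈⟨ +-congʳ (*-congˡ uu⁻¹≈1) ⟨
          a * (u * u⁻¹) - u⁻¹      ≈⟨ solve 3 (λ a u y → a :* (u :* y) :- y := (:1 :- a :* u) :* :- y) refl a u u⁻¹ ⟩
          (1# - a * u) * - u⁻¹     ∎)

        a⁻¹~u : a⁻¹ ~ u [ 1# - a * u ]
        a⁻¹~u = mk~ a⁻¹∈ u∈ a⁻¹ a⁻¹∈ (begin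
          a⁻¹ - u                  ≈⟨ solve 2 (λ b u → b :- u := b :- :1 :* u) refl a⁻¹ u ⟩
          a⁻¹ - 1# * u             ≈⟨ +-congˡ (-‿cong (*-congʳ aa⁻¹≈1)) ⟨
          a⁻¹ - (a * a⁻¹) * u      ≈⟨ solve 3 (λ a b u → b :- (a :* b) :* u := (:1 :- a :* u) :* b) refl a a⁻¹ u ⟩
          (1# - a * u) * a⁻¹       ∎)

        a~u : a ~ u [ a - u ]
        a~u = mk~ a∈ u∈ 1# 1∈ (sym (*-identityʳ _))

        a⁻¹~u⁻¹ : a⁻¹ ~ u⁻¹ [ a - u ]
        a⁻¹~u⁻¹ = mk~ a⁻¹∈ u⁻¹∈ (- (a⁻¹ * u⁻¹)) (-‿∈ (*-∈ a⁻¹∈ u⁻¹∈)) (begin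
          a⁻¹ - u⁻¹                            ≈⟨ solve 2 (λ b y → b :- y := b :* :1 :- y :* :1) refl a⁻¹ u⁻¹ ⟩
          a⁻¹ * 1# - u⁻¹ * 1#                  ≈⟨ +-cong (*-congˡ uu⁻¹≈1) (-‿cong (*-congˡ aa⁻¹≈1)) ⟨
          a⁻¹ * (u * u⁻¹) - u⁻¹ * (a * a⁻¹)    ≈⟨ solve 4 (λ a b u y → b :* (u :* y) :- y :* (a :* b)
                                                   := (a :- u) :* :- (b :* y)) refl a a⁻¹ u u⁻¹ ⟩
          (a - u) * - (a⁻¹ * u⁻¹)              ∎)

        -- Here aq and q/a become Q⁻ᵐ and Qᵐ⁺¹; in `at-u` they change places. The evaluated sum
        -- equals `B` because both invert `δ m 0`.
        at-u⁻¹ : ∑< (suc m) (term s (a * q) (q * a⁻¹)) ~ B [ 1# - a * u ]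
        at-u⁻¹ = ~-respʳ (inverse-unique (∑⟨Q⁻ᵐ⟩⟨Qᵐ⁺¹⟩ m s vQᵐ≈1) δB≈1)
          (∑term-~ (suc m) s (~-respʳ u⁻¹q≈v (~-* a~u⁻¹ (~-refl q∈)))
            (~-respʳ (trans (*-comm q u) uq≈Qᵐ⁺¹) (~-* (~-refl q∈) a⁻¹~u)))

        at-u : ∑< (suc m) (term s (a * q) (q * a⁻¹)) ~ B [ a - u ]
        at-u = ~-respʳ (inverse-unique (∑⟨Qᵐ⁺¹⟩⟨Q⁻ᵐ⟩ m s s≤m vQᵐ≈1) δB≈1)
          (∑term-~ (suc m) s (~-respʳ uq≈Qᵐ⁺¹ (~-* a~u (~-refl q∈)))
            (~-respʳ (trans (*-comm q u⁻¹) u⁻¹q≈v) (~-* (~-refl q∈) a⁻¹~u⁻¹)))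

      -- The two moduli are comaximal up to the unit 1 - u² = (1 - au) + u(a - u).
      ∑term-~-product : ∀ {e} → e ∈S → (1# - u * u) * e ≈ 1# →
        ∑< (suc m) (term s (a * q) (q * a⁻¹)) ~ B [ (1# - a * u) * (a - u) ]
      -- The difference x equals both (1 - au) d₁ and (a - u) d₂. Using each form in the term that
      -- carries the other modulus gives x(1 - u²) = (1 - au)(a - u)(d₂ + u d₁), and `e` inverts 1 -
      -- u².
      ∑term-~-product {e} e∈ ue≈1 = mk~ (left∈ at-u) (right∈ at-u) ((d₂ + u * d₁) * e)
        (*-∈ (+-∈ (quotient∈ at-u) (*-∈ u∈ (quotient∈ at-u⁻¹))) e∈) (begin
          x                                                      ≈⟨ *-identityʳ x ⟨
          x * 1#                                                 ≈⟨ *-congˡ ue≈1 ⟨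
          x * ((1# - u * u) * e)                                 ≈⟨ solve 4 (λ x u e a → x :* ((:1 :- u :* u) :* e)
                                                                      := ((:1 :- a :* u) :* x :+ (u :* (a :- u)) :* x) :* e)
                                                                      refl x u e a ⟩
          ((1# - a * u) * x + (u * (a - u)) * x) * e             ≈⟨ *-congʳ (+-cong (*-congˡ (equation at-u))
                                                                      (*-congˡ (equation at-u⁻¹))) ⟩
          ((1# - a * u) * ((a - u) * d₂) + (u * (a - u)) * ((1# - a * u) * d₁)) * e
            ≈⟨ solve 6 (λ p₁ p₂ u d₁ d₂ e → (p₁ :* (p₂ :* d₂) :+ (u :* p₂) :* (p₁ :* d₁)) :* e
                 := (p₁ :* p₂) :* ((d₂ :+ u :* d₁) :* e)) refl (1# - a * u) (a - u) u d₁ d₂ e ⟩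
          ((1# - a * u) * (a - u)) * ((d₂ + u * d₁) * e) ∎)
        where
        x = ∑< (suc m) (term s (a * q) (q * a⁻¹)) - B
        d₁ = quotient at-u⁻¹
        d₂ = quotient at-u

-- The subring of fractions with denominators in a multiplicative set.

module Localisation {c ℓ c′ ℓ′} (R : CommutativeRing c ℓ) (F : CommutativeRing c′ ℓ′) where
  private module R = CommutativeRing R
  open CommutativeRing F

  module Embedding
    {r} (ι : R.Carrier → Carrier)
    (ι-1 : ι R.1# ≈ 1#)
    (ι-+ : ∀ x y → ι (x R.+ y) ≈ ι x + ι y)
    (ι-* : ∀ x y → ι (x R.* y) ≈ ι x * ι y)
    (ι-neg : ∀ x → ι (R.- x) ≈ - ι x)
    (Denominator : R.Carrier → Set r)
    (denominator-1 : Denominator R.1#)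
    (denominator-* : ∀ {x y} → Denominator x → Denominator y → Denominator (x R.* y))
    where

    open RingSolver F
    open Relation.Binary.Reasoning.Setoid setoid

    -- The denominator is cleared rather than inverted, so the closure properties need only the ring
    -- laws of F.
    Local : Carrier → Set (c ⊔ ℓ′ ⊔ r)
    Local x = Σ[ N ∈ R.Carrier ] Σ[ D ∈ R.Carrier ] Denominator D × x * ι D ≈ ι N

    ι-local : ∀ x → Local (ι x)
    ι-local x = x , R.1# , denominator-1 , trans (*-congˡ ι-1) (*-identityʳ _)

    inverse-local : ∀ x D → Denominator D → ι D * x ≈ 1# → Local x
    inverse-local x D D∈ e = R.1# , D , D∈ , trans (*-comm _ _) (trans e (sym ι-1))

    subring : Subring F (c ⊔ ℓ′ ⊔ r)
    subring = record
      { _∈S = Local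
      ; ∈-resp = λ { x≈y (N , D , D∈ , e) → N , D , D∈ , trans (*-congʳ (sym x≈y)) e }
      ; 1∈ = R.1# , R.1# , denominator-1 , *-identityˡ _
      ; +-∈ = λ { {x} {y} (N , D , D∈ , e) (N′ , D′ , D′∈ , e′) →
          N R.* D′ R.+ N′ R.* D , D R.* D′ , denominator-* D∈ D′∈ , (begin
            (x + y) * ι (D R.* D′)                 ≈⟨ *-congˡ (ι-* D D′) ⟩
            (x + y) * (ι D * ι D′)                 ≈⟨ solve 4 (λ x y D D′ → (x :+ y) :* (D :* D′)
                                                        := (x :* D) :* D′ :+ (y :* D′) :* D) refl x y (ι D) (ι D′) ⟩
            (x * ι D) * ι D′ + (y * ι D′) * ι D    ≈⟨ +-cong (*-congʳ e) (*-congʳ e′) ⟩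
            ι N * ι D′ + ι N′ * ι D                ≈⟨ +-cong (ι-* N D′) (ι-* N′ D) ⟨
            ι (N R.* D′) + ι (N′ R.* D)            ≈⟨ ι-+ _ _ ⟨
            ι (N R.* D′ R.+ N′ R.* D)              ∎) }
      ; *-∈ = λ { {x} {y} (N , D , D∈ , e) (N′ , D′ , D′∈ , e′) →
          N R.* N′ , D R.* D′ , denominator-* D∈ D′∈ , (begin
            (x * y) * ι (D R.* D′)      ≈⟨ *-congˡ (ι-* D D′) ⟩
            (x * y) * (ι D * ι D′)      ≈⟨ solve 4 (λ x y D D′ → (x :* y) :* (D :* D′)
                                             := (x :* D) :* (y :* D′)) refl x y (ι D) (ι D′) ⟩
            (x * ι D) * (y * ι D′)      ≈⟨ *-cong e e′ ⟩
            ι N * ι N′                  ≈⟨ ι-* N N′ ⟨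
            ι (N R.* N′)                ∎) }
      ; -‿∈ = λ { {x} (N , D , D∈ , e) → R.- N , D , D∈ , (begin
            - x * ι D      ≈⟨ solve 2 (λ x D → :- x :* D := :- (x :* D)) refl x (ι D) ⟩
            - (x * ι D)    ≈⟨ -‿cong e ⟩
            - ι N          ≈⟨ ι-neg N ⟨
            ι (R.- N)      ∎) }
      }

-- Coprimality of Xⁱ d with (1 - Xu)(X - u).

module PolynomialCoprimality {c ℓ} (R : Domain c ℓ) where
  open Domain R hiding (zero)
  open Polynomial R
  private module Pol = Domain polyDomain

  -- Lists may end in zeros, so the degree is read off from the coefficients and not from the
  -- length.
  record Degree (p : Poly) (i : ℕ) : Set ℓ where
    constructor mkDegree
    field
      leading≉0 : ¬ (coeff p i ≈ 0#)
      above≈0   : ∀ {j} → i ℕ.< j → coeff p j ≈ 0#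
  open Degree

  degree : ∀ p → ¬ (p ≈ₚ []) → ∃ (Degree p)
  degree []      p≉0 = ⊥-elim (p≉0 ≈ₚ-refl)
  degree (x ∷ p) xp≉0 with p ≟[]
  ... | yes p≈0 = 0 , mkDegree (λ x≈0 → xp≉0 (∷-≈[] x≈0 p≈0)) λ { {suc j} _ → coeff-≈ p≈0 j }
  ... | no  p≉0 with degree p p≉0
  ...   | i , mkDegree l a = suc i , mkDegree l λ { {suc j} i<j → a (ℕ.s≤s⁻¹ i<j) }

  coeff-*-degree : ∀ {p r i j} → Degree p i → Degree r j →
                   coeff (p *ₚ r) (i ℕ.+ j) ≈ coeff p i * coeff r j
  coeff-*-degree {[]}                     dp dr = ⊥-elim (leading≉0 dp refl)
  coeff-*-degree {x ∷ p} {r} {zero}  {j} dp dr =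
    trans (coeff-+ (x · r) _ j) (trans (+-cong (coeff-· x r j) (coeff-≈ 0∷pr≈[] j)) (+-identityʳ _))
    where
    0∷pr≈[] : (0# ∷ p *ₚ r) ≈ₚ []
    0∷pr≈[] = ∷-≈[] refl (≈[]⇒*ₚ≈[] {p} r (mk≈ₚ λ k → above≈0 dp {suc k} (ℕ.s≤s ℕ.z≤n)))
  coeff-*-degree {x ∷ p} {r} {suc i} {j} dp dr =
    trans (coeff-+ (x · r) _ (suc i ℕ.+ j))
      (trans (+-cong
        (trans (coeff-· x r (suc i ℕ.+ j)) (trans (*-congˡ (above≈0 dr (ℕ.s≤s (ℕ.m≤n+m j i)))) (zeroʳ x)))
        (coeff-*-degree {p} {r} {i} {j}
          (mkDegree (leading≉0 dp) λ i<k → above≈0 dp (ℕ.s≤s i<k)) dr))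
      (+-identityˡ _))

  *ₚ-const : ∀ p x → p *ₚ const x ≈ₚ x · p
  *ₚ-const p x = ≈ₚ-trans (*ₚ-comm p (const x))
    (≈ₚ-trans (+ₚ-cong ≈ₚ-refl (∷-≈[] refl ≈ₚ-refl)) (+ₚ-identityʳ (x · p)))

  -- Degrees add over a domain. If `r` had positive degree, the product of the two leading
  -- coefficients would be a coefficient of `const d` at a positive index, hence zero.
  divides-const⇒const : ∀ p r {d} → ¬ (d ≈ 0#) → p *ₚ r ≈ₚ const d → r ≈ₚ const (coeff r 0)
  divides-const⇒const p r {d} d≉0 e
    with degree p (λ p≈0 → d≉0 (head-≈[] (≈ₚ-trans (≈ₚ-sym e) (≈[]⇒*ₚ≈[] r p≈0))))
       | degree r (λ r≈0 → d≉0 (head-≈[] (≈ₚ-trans (≈ₚ-sym e) (≈ₚ-trans (*ₚ-comm p r) (≈[]⇒*ₚ≈[] p r≈0)))))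
  ... | _     , _  | zero  , dr = mk≈ₚ λ { zero → refl ; (suc j) → above≈0 dr (ℕ.s≤s ℕ.z≤n) }
  ... | i     , dp | suc j , dr with integral (trans (sym (coeff-*-degree {p} {r} dp dr))
                                    (trans (coeff-≈ e (i ℕ.+ suc j)) (high i j)))
    where
    high : ∀ i j → coeff (const d) (i ℕ.+ suc j) ≈ 0#
    high zero    j = refl
    high (suc i) j = refl
  ...   | inj₁ z = ⊥-elim (leading≉0 dp z)
  ...   | inj₂ z = ⊥-elim (leading≉0 dr z)

  X-* : ∀ p → X *ₚ p ≈ₚ (0# ∷ p)
  X-* p = ≈ₚ-trans (0∷-*ₚ (const 1#) p) (∷-cong refl (*ₚ-identityˡ p))

  -- Constant terms give w₀ z₀ = 0 with z₀ nonzero, so w₀ = 0 and `w` is X times its tail, the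
  -- witness.
  cancel-X : ∀ w z p → ¬ (coeff z 0 ≈ 0#) → w *ₚ z ≈ₚ X *ₚ p → ∃ λ w′ → w′ *ₚ z ≈ₚ p
  cancel-X [] z p z₀≉0 e = [] , tail-≈′ (≈ₚ-trans e (X-* p))
    where
    tail-≈′ : [] ≈ₚ (0# ∷ p) → [] ≈ₚ p
    tail-≈′ f = mk≈ₚ λ i → coeff-≈ f (suc i)
  cancel-X (y ∷ w) z p z₀≉0 e
    with integral (trans (sym (coeff-*-0 (y ∷ w) z)) (coeff-≈ (≈ₚ-trans e (X-* p)) 0))
  ... | inj₂ z₀≈0 = ⊥-elim (z₀≉0 z₀≈0)
  ... | inj₁ y≈0  = w , tail-≈ (≈ₚ-trans (≈ₚ-sym (0∷-*ₚ w z))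
          (≈ₚ-trans (*ₚ-cong {0# ∷ w} {y ∷ w} {z} (∷-cong (sym y≈0) ≈ₚ-refl) ≈ₚ-refl)
            (≈ₚ-trans e (X-* p))))

  cancel-X^ : ∀ i w z p → ¬ (coeff z 0 ≈ 0#) → w *ₚ z ≈ₚ X Pol.^ i *ₚ p → ∃ λ w′ → w′ *ₚ z ≈ₚ p
  cancel-X^ zero    w z p z₀≉0 e = w , ≈ₚ-trans e (*ₚ-identityˡ p)
  cancel-X^ (suc i) w z p z₀≉0 e
    with cancel-X w z (X Pol.^ i *ₚ p) z₀≉0 (≈ₚ-trans e (*ₚ-assoc X (X Pol.^ i) p))
  ... | w′ , e′ = cancel-X^ i w′ z p z₀≉0 e′

  -- A common divisor z has a nonzero constant term because P has one, so Xⁱ cancels and z divides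
  -- `const d`; hence z is constant. Constants of R need not be units, but z divides every
  -- coefficient of P, two of which combine to 1.
  Xⁱd-coprime : ∀ i {d P D} α β → ¬ (d ≈ 0#) → ¬ (coeff P 0 ≈ 0#) →
    α * coeff P 0 + β * coeff P 1 ≈ 1# → D ≈ₚ X Pol.^ i *ₚ const d → Pol.Coprime D P
  Xⁱd-coprime i {d} {P} α β d≉0 P₀≉0 unit D≈ {z} (w , wz≈D) (v , vz≈P)
    with cancel-X^ i w z (const d) z₀≉0 (≈ₚ-trans wz≈D D≈)
    where
    z₀≉0 : ¬ (coeff z 0 ≈ 0#)
    z₀≉0 z₀≈0 = P₀≉0 (trans (sym (coeff-≈ vz≈P 0)) (trans (coeff-*-0 v z) (trans (*-congˡ z₀≈0) (zeroʳ _))))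
  ... | w′ , w′z≈d = const γ , ≈ₚ-trans (*ₚ-cong {const γ} ≈ₚ-refl z≈) (∷-cong γz₀≈1 ≈ₚ-refl)
    where
    z₀ = coeff z 0
    γ  = α * coeff v 0 + β * coeff v 1
    z≈ : z ≈ₚ const z₀
    z≈ = divides-const⇒const w′ z d≉0 w′z≈d
    P-coeff : ∀ j → coeff P j ≈ z₀ * coeff v j
    P-coeff j = trans (sym (coeff-≈ vz≈P j))
      (trans (coeff-≈ (≈ₚ-trans (*ₚ-cong {v} ≈ₚ-refl z≈) (*ₚ-const v z₀)) j) (coeff-· z₀ v j))
    γz₀≈1 : γ * z₀ + 0# ≈ 1#
    γz₀≈1 = trans
      (solve 5 (λ α v₀ β v₁ z → (α :* v₀ :+ β :* v₁) :* z :+ :0 := α :* (z :* v₀) :+ β :* (z :* v₁))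
        refl α (coeff v 0) β (coeff v 1) z₀)
      (trans (sym (+-cong (*-congˡ (P-coeff 0)) (*-congˡ (P-coeff 1)))) unit)
      where
      open RingSolver commutativeRing

  const-* : ∀ x y → const (x * y) ≈ₚ const x *ₚ const y
  const-* x y = ∷-cong (sym (+-identityʳ _)) ≈ₚ-refl

  const-^ : ∀ x n → const x Pol.^ n ≈ₚ const (x ^ n)
  const-^ x zero    = ≈ₚ-refl
  const-^ x (suc n) = ≈ₚ-trans (*ₚ-cong {const x} ≈ₚ-refl (const-^ x n)) (≈ₚ-sym (const-* x (x ^ n)))

  -- Modulo a common divisor free of X, the coefficients -u and 1 + u² of
  -- (1 - Xu)(X - u) generate the unit ideal: u · (-u) + (1 + u²) = 1.
  Xⁱd-coprime-[1-Xu][X-u] : ∀ i {d D U} u → ¬ (d ≈ 0#) → ¬ (u ≈ 0#) → U ≈ₚ const u →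
    D ≈ₚ X Pol.^ i *ₚ const d → Pol.Coprime D ((Pol.1# Pol.- X Pol.* U) Pol.* (X Pol.- U))
  Xⁱd-coprime-[1-Xu][X-u] i {U = U} u d≉0 u≉0 U≈u =
    Xⁱd-coprime i {P = P} u 1# d≉0
      (λ P₀≈0 → u≉0 (trans (solve 1 (λ u → u := :- (:1 :* (:- u) :+ :0)) refl u)
         (trans (-‿cong (trans (sym (coeff-≈ P≈ 0)) P₀≈0)) (solve 0 (:- :0 := :0) refl))))
      (trans (+-cong (*-congˡ (coeff-≈ P≈ 0)) (*-congˡ (coeff-≈ P≈ 1)))
        (solve 1 (λ u → u :* (:1 :* (:- u) :+ :0) :+ :1 :* (:1 :* :1 :+ ((:- u) :* (:- u) :+ :0)) := :1) refl u))
    where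
    open RingSolver commutativeRing
    P : Poly
    P = (Pol.1# Pol.- X Pol.* U) Pol.* (X Pol.- U)
    1-XU≈ : (Pol.1# Pol.- X Pol.* U) ≈ₚ (1# ∷ - u ∷ [])
    1-XU≈ = ≈ₚ-trans (Pol.+-congˡ (Pol.-‿cong (≈ₚ-trans (X-* U) (∷-cong refl U≈u))))
      (∷-cong (solve 0 (:1 :- :0 := :1) refl) ≈ₚ-refl)
    X-U≈ : (X Pol.- U) ≈ₚ (- u ∷ 1# ∷ [])
    X-U≈ = ≈ₚ-trans (Pol.+-congˡ (Pol.-‿cong U≈u)) (∷-cong (+-identityˡ _) ≈ₚ-refl)
    P≈ : P ≈ₚ (1# ∷ - u ∷ []) *ₚ (- u ∷ 1# ∷ [])
    P≈ = *ₚ-cong 1-XU≈ X-U≈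

-- Transfer to the fraction field of R₀[X], to be used with R₀ = ℚ[q], X = a and x = q.

module Generic {c ℓ} (R₀ : Domain c ℓ) (x : Domain.Carrier R₀) where
  private
    module R₀ = Domain R₀
    open Polynomial R₀
    open PolynomialCoprimality R₀ using (const-*; const-^; Xⁱd-coprime-[1-Xu][X-u])
    module Pol = Domain polyDomain
    open Algebra.Properties.Semiring.Exp Pol.semiring using (^-homo-*)
  open Fractions polyDomain

  a q : Carrier
  a = ι X
  q = ι (const x)

  -- The power of X comes from q / a; the constants d come from q, from (q²; q²)ₖ and from 1 - u².
  Denominator : Poly → Set (c ⊔ ℓ)
  Denominator D = Σ[ i ∈ ℕ ] Σ[ d ∈ R₀.Carrier ] ¬ (d R₀.≈ R₀.0#) × D ≈ₚ X Pol.^ i *ₚ const d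

  const-denominator : ∀ {d} → ¬ (d R₀.≈ R₀.0#) → Denominator (const d)
  const-denominator {d} d≉0 = 0 , d , d≉0 , ≈ₚ-sym (*ₚ-identityˡ (const d))

  X-denominator : Denominator X
  X-denominator = 1 , R₀.1# , R₀.1≉0 , ≈ₚ-sym (≈ₚ-trans (Pol.*-identityʳ _) (Pol.*-identityʳ _))

  denominator-* : ∀ {D E} → Denominator D → Denominator E → Denominator (D *ₚ E)
  denominator-* {D} {E} (i , d , d≉0 , D≈) (j , e , e≉0 , E≈) =
    i ℕ.+ j , d R₀.* e , FractionField.*-≉0 R₀ d≉0 e≉0 , (begin
      D *ₚ E
        ≈⟨ *ₚ-cong D≈ E≈ ⟩
      (X Pol.^ i *ₚ const d) *ₚ (X Pol.^ j *ₚ const e)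
        ≈⟨ interchange (X Pol.^ i) (const d) (X Pol.^ j) (const e) ⟩
      (X Pol.^ i *ₚ X Pol.^ j) *ₚ (const d *ₚ const e)
        ≈⟨ *ₚ-cong (^-homo-* X i j) (const-* d e) ⟨
      X Pol.^ (i ℕ.+ j) *ₚ const (d R₀.* e) ∎)
    where
    open Algebra.Properties.CommutativeSemigroup Pol.*-commutativeSemigroup using (interchange)
    open Relation.Binary.Reasoning.Setoid ≈ₚ-setoid

  denominator≉0 : ∀ {D} → Denominator D → ¬ (D ≈ₚ [])
  denominator≉0 (i , d , d≉0 , D≈) D≈0 = FractionField.*-≉0 polyDomain {X Pol.^ i} {const d} (X^≉0 i)
    (λ d≈0 → d≉0 (head-≈[] d≈0)) (≈ₚ-trans (≈ₚ-sym D≈) D≈0)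
    where
    X^≉0 : ∀ i → ¬ (X Pol.^ i ≈ₚ [])
    X^≉0 zero    = Pol.1≉0
    X^≉0 (suc i) = FractionField.*-≉0 polyDomain {X} {X Pol.^ i} (λ X≈0 → R₀.1≉0 (coeff-≈ X≈0 1)) (X^≉0 i)

  open Localisation.Embedding polyRing commutativeRing ι refl ι-+ ι-* ι-neg
    Denominator (const-denominator R₀.1≉0) denominator-*

  Constant : Carrier → Set (c ⊔ ℓ)
  Constant y = Σ[ d ∈ R₀.Carrier ] y ≈ ι (const d)

  1-constant : Constant 1#
  1-constant = R₀.1# , refl

  q-constant : Constant q
  q-constant = x , refl

  *-constant : ∀ {y z} → Constant y → Constant z → Constant (y * z)
  *-constant (d , y≈) (e , z≈) = d R₀.* e , trans (*-cong y≈ z≈)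
    (trans (sym (ι-* (const d) (const e))) (ι-cong (≈ₚ-sym (const-* d e))))

  sub-constant : ∀ {y z} → Constant y → Constant z → Constant (y - z)
  sub-constant (d , y≈) (e , z≈) = d R₀.- e , trans (+-cong y≈ (-‿cong z≈))
    (trans (+-congˡ {ι (const d)} (sym (ι-neg (const e)))) (sym (ι-+ (const d) (-ₚ const e))))

  ^-constant : ∀ {y} m → Constant y → Constant (y ^ m)
  ^-constant zero    y-const = 1-constant
  ^-constant (suc m) y-const = *-constant y-const (^-constant m y-const)

  ⟨⟩-constant : ∀ {y b} m → Constant y → Constant b → Constant (⟨ y ⨾ b ⟩ m)
  ⟨⟩-constant zero    y-const b-const = 1-constant
  ⟨⟩-constant (suc m) y-const b-const = *-constant (⟨⟩-constant m y-const b-const)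
    (sub-constant 1-constant (*-constant y-const (^-constant m b-const)))

  -- The element d of R₀ carried along by `Constant` is itself an admissible denominator, so
  -- factorials are never expanded as polynomials.
  constant⁻¹-local : ∀ {y} → Constant y → ¬ (y ≈ 0#) → Local (y ⁻¹)
  constant⁻¹-local {y} (d , y≈) y≉0 = inverse-local (y ⁻¹) (const d)
    (const-denominator λ d≈0 → y≉0 (trans y≈ (ι-cong (∷-≈[] d≈0 ≈ₚ-refl))))
    (trans (*-congʳ {y ⁻¹} (sym y≈)) (⁻¹-inverseʳ y y≉0))

  open Congruence subring using (_~_[_]; mk~)

  -- The denominator `D` that clears the quotient also serves as the one `Congruent` asks for, since
  -- the whole multiplicative set is coprime to `P`.
  ~⇒Congruent : ∀ {A A′ B p P} → A′ ≈ A → ι P ≈ p → (∀ {D} → Denominator D → Pol.Coprime D P) →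
                A′ ~ B [ p ] → Congruent A B P
  ~⇒Congruent {A} {A′} {B} {p} {P} A′≈A ιP≈p coprime (mk~ _ _ y (N , D , D∈ , yD≈N) eq) =
    N , D , denominator≉0 D∈ , (λ {z} → coprime D∈ {z}) , (begin
      A - B                  ≈⟨ +-congʳ {(- B)} A′≈A ⟨
      A′ - B                 ≈⟨ eq ⟩
      p * y                  ≈⟨ *-cong {ι P} {p} ιP≈p (sym y≈) ⟨
      ι P * (ι N / ι D)      ∎)
    where
    open Relation.Binary.Reasoning.Setoid setoid
    y≈ : y ≈ ι N / ι D
    y≈ = begin
      y                      ≈⟨ *-identityʳ y ⟨
      y * 1#                 ≈⟨ *-congˡ {y} (⁻¹-inverseʳ (ι D) (λ ιD≈0 → denominator≉0 D∈ (ι-injective ιD≈0))) ⟨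
      y * (ι D * ι D ⁻¹)     ≈⟨ *-assoc y (ι D) (ι D ⁻¹) ⟨
      y * ι D * ι D ⁻¹       ≈⟨ *-congʳ {ι D ⁻¹} yD≈N ⟩
      ι N / ι D              ∎

  ⟨⟩-agrees : ∀ b y m → ⟨ y ⨾ b ⟩ m ≡.≡ QSeries.⟨_⟩_ commutativeRing b y m
  ⟨⟩-agrees b y zero    = ≡.refl
  ⟨⟩-agrees b y (suc m) = ≡.cong (_* (1# - y * b ^ m)) (⟨⟩-agrees b y m)

  ^ᶻ-neg-inverse : ∀ {y} N → ¬ (y ≈ 0#) → y ^ N * y ^ᶻ (ℤ.- + N) ≈ 1#
  ^ᶻ-neg-inverse zero    y≉0 = *-identityʳ 1#
  ^ᶻ-neg-inverse {y} (suc N) y≉0 = ⁻¹-inverseʳ (y ^ suc N) (^-≉0 y≉0 (suc N))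

  module _ (a≉0 : ¬ (a ≈ 0#)) (q≉0 : ¬ (q ≈ 0#)) (⟨q²⟩≉0 : ∀ m → ¬ (⟨ q ^ 2 ⨾ q ^ 2 ⟩ m ≈ 0#)) where

    ρ : ℕ → Carrier
    ρ k = (⟨ q ^ 2 ⨾ q ^ 2 ⟩ k) ⁻¹

    private
      q²-constant : Constant (q ^ 2)
      q²-constant = ^-constant 2 q-constant

      module S = Specialisation.Sum subring q a (a ⁻¹) (q ⁻¹) ρ
        (ι-local X)
        (inverse-local (a ⁻¹) X X-denominator (⁻¹-inverseʳ a a≉0))
        (ι-local (const x))
        (constant⁻¹-local q-constant q≉0)
        (λ k → constant⁻¹-local (⟨⟩-constant k q²-constant q²-constant) (⟨q²⟩≉0 k))
        (⁻¹-inverseʳ a a≉0)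
        (⁻¹-inverseʳ q q≉0)
        (λ k → trans (*-congʳ {ρ k} (reflexive (≡.sym (⟨⟩-agrees (q ^ 2) (q ^ 2) k))))
          (⁻¹-inverseʳ (⟨ q ^ 2 ⨾ q ^ 2 ⟩ k) (⟨q²⟩≉0 k)))

      *⁻¹-homo : ∀ {y z} → ¬ (y ≈ 0#) → ¬ (z ≈ 0#) → (y * z) ⁻¹ ≈ y ⁻¹ * z ⁻¹
      *⁻¹-homo {y} {z} y≉0 z≉0 = Units.inverse-unique commutativeRing {y * z} (⁻¹-inverseʳ (y * z) (*ᶠ-≉0 y≉0 z≉0))
        (trans (interchange y z (y ⁻¹) (z ⁻¹))
          (trans (*-cong (⁻¹-inverseʳ y y≉0) (⁻¹-inverseʳ z z≉0)) (*-identityʳ 1#)))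
        where
        open Algebra.Properties.CommutativeSemigroup *-commutativeSemigroup using (interchange)

    term : ℕ → ℕ → Carrier
    term s k = (⟨ a * q ⨾ q ^ 2 ⟩ k * ⟨ q / a ⨾ q ^ 2 ⟩ (k ℕ.+ s))
                 / (⟨ q ^ 2 ⨾ q ^ 2 ⟩ k * ⟨ q ^ 2 ⨾ q ^ 2 ⟩ (k ℕ.+ s))

    private
      term≈ : ∀ s k → S.term s (a * q) (q * a ⁻¹) k ≈ term s k
      term≈ s k = *-cong
        (*-cong (reflexive (≡.sym (⟨⟩-agrees (q ^ 2) (a * q) k)))
                (reflexive (≡.sym (⟨⟩-agrees (q ^ 2) (q / a) (k ℕ.+ s)))))
        (sym (*⁻¹-homo (⟨q²⟩≉0 k) (⟨q²⟩≉0 (k ℕ.+ s))))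

      modulus : ℕ → Poly
      modulus n = (Pol.1# Pol.- X Pol.* (const x Pol.^ n)) Pol.* (X Pol.- (const x Pol.^ n))

      ι-modulus : ∀ m → let u = q * (q ^ 2) ^ m in
                  ι (modulus (suc (2 ℕ.* m))) ≈ (1# - a * u) * (a - u)
      ι-modulus m = trans (ι-* (Pol.1# Pol.- X Pol.* U) (X Pol.- U))
        (*-cong (trans (ι-+ Pol.1# (Pol.- (X Pol.* U)))
                   (+-congˡ {1#} (-‿cong (trans (ι-* X U) (*-congˡ {a} ιU≈)))))
                (trans (ι-+ X (Pol.- U)) (+-congˡ {a} (-‿cong ιU≈))))
        where
        U : Poly
        U = const x Pol.^ suc (2 ℕ.* m)
        ιU≈ : ι U ≈ q * (q ^ 2) ^ m
        ιU≈ = trans (ι-^ (const x) (suc (2 ℕ.* m))) (SquareBase.q^odd≈ commutativeRing q m)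

      module _ (m : ℕ) where

        u : Carrier
        u = q * (q ^ 2) ^ m

        u-constant : Constant u
        u-constant = *-constant q-constant (^-constant m q²-constant)

        -- Since u² = Q · Q²ᵐ, the element 1 - u² is the last factor of (Q; Q)₂ₘ₊₁, which is already
        -- known to be nonzero.
        1-u²≉0 : ¬ (1# - u * u ≈ 0#)
        1-u²≉0 e = ⟨q²⟩≉0 (suc (m ℕ.+ m)) (trans
          (*-congˡ {⟨ q ^ 2 ⨾ q ^ 2 ⟩ (m ℕ.+ m)} (trans (+-congˡ {1#} (-‿cong (sym (SquareBase.[q^odd]²≈ commutativeRing q m)))) e))
          (zeroʳ (⟨ q ^ 2 ⨾ q ^ 2 ⟩ (m ℕ.+ m))))

        xⁿ≉0 : ¬ (x R₀.^ suc (2 ℕ.* m) R₀.≈ R₀.0#)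
        xⁿ≉0 e = ^-≉0 q≉0 (suc (2 ℕ.* m)) (trans (sym (ι-^ (const x) (suc (2 ℕ.* m))))
          (ι-cong (≈ₚ-trans (const-^ x (suc (2 ℕ.* m))) (∷-≈[] e ≈ₚ-refl))))

        rhs : Carrier
        rhs = (- 1#) ^ m * q ^ᶻ (ℤ.- + (m ℕ.* suc m))

        ∑term-~ : ∀ s → s ℕ.≤ m →
          QSeries.∑< commutativeRing (q ^ 2) (suc m) (S.term s (a * q) (q * a ⁻¹)) ~ rhs
            [ (1# - a * u) * (a - u) ]
        ∑term-~ s s≤m = S.∑term-~-product m s s≤m {rhs}
          (SquareBase.δ₀-inverse commutativeRing q m {q ^ᶻ (ℤ.- + (m ℕ.* suc m))} (^ᶻ-neg-inverse (m ℕ.* suc m) q≉0))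
          {(1# - u * u) ⁻¹}
          (constant⁻¹-local (sub-constant 1-constant (*-constant u-constant u-constant)) 1-u²≉0)
          (⁻¹-inverseʳ (1# - u * u) 1-u²≉0)

    -- The exponents `n` and `z` come with equations, so that matching on `refl` replaces a
    -- transport of the congruence.
    ∑term-congruent : ∀ m s → s ℕ.≤ m →
      ∀ {n z} → n ≡.≡ suc (2 ℕ.* m) → z ≡.≡ ℤ.- + (m ℕ.* suc m) →
      Congruent (∑[ k ⩽ m ] term s k) ((- 1#) ^ m * q ^ᶻ z) (modulus n)
    ∑term-congruent m s s≤m ≡.refl ≡.refl =
      ~⇒Congruent {B = rhs m} {P = modulus (suc (2 ℕ.* m))}
        (QSeries.∑<-cong commutativeRing (q ^ 2) (suc m) (term≈ s)) (ι-modulus m)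
        (λ { (i , d , d≉0 , D≈) → Xⁱd-coprime-[1-Xu][X-u] i (x R₀.^ suc (2 ℕ.* m)) d≉0 (xⁿ≉0 m)
               (const-^ x (suc (2 ℕ.* m))) D≈ })
        (∑term-~ m s s≤m)

-- Arithmetic of the exponents for odd n.

odd⇒1+2* : ∀ k → ¬ (2 ∣ suc k) → suc k ≡ suc (2 ℕ.* (k ℕ./ 2))
odd⇒1+2* k 2∤1+k with k ℕ.% 2 | ℕ.m≡m%n+[m/n]*n k 2 | ℕ.m%n<n k 2
... | 0 | k≡ | _ = ≡.cong suc (≡.trans k≡ (ℕ.*-comm (k ℕ./ 2) 2))
... | 1 | k≡ | _ = ⊥-elim (2∤1+k (divides (suc (k ℕ./ 2)) (≡.cong suc k≡)))
... | suc (suc _) | _ | ℕ.s≤s (ℕ.s≤s ())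

-- Integer division of a negative number branches on the remainder; here it is 0, so nothing is
-- rounded.
-[N*4]/4≡-N : ∀ N → (ℤ.- + (N ℕ.* 4)) ℤ./ + 4 ≡ ℤ.- + N
-[N*4]/4≡-N zero = ≡.refl
-[N*4]/4≡-N (suc N) rewrite ℕ.m*n%n≡0 (suc N) 4 {{_}} | ℕ.m*n/n≡m (suc N) 4 {{_}} = ℤ.*-identityˡ (ℤ.- + suc N)

-- By 1 - (2m + 1)² = -4m(m + 1) the division by 4 in the theorem is exact, and its result is
-- opposite to the exponent in `δ₀≈`.
exponent≡ : ∀ m → (+ 1 ℤ.- + (suc (2 ℕ.* m) ℕ.^ 2)) ℤ./ + 4 ≡ ℤ.- + (m ℕ.* suc m)
exponent≡ m = ≡.trans (≡.cong (ℤ._/ + 4) numerator≡) (-[N*4]/4≡-N (m ℕ.* suc m))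
  where
  open +-*-Solver
  square≡ : suc (2 ℕ.* m) ℕ.^ 2 ≡ suc (m ℕ.* suc m ℕ.* 4)
  square≡ = solve 1 (λ m → (con 1 :+ con 2 :* m) :* ((con 1 :+ con 2 :* m) :* con 1)
                          := con 1 :+ m :* (con 1 :+ m) :* con 4) ≡.refl m
  numerator≡ : + 1 ℤ.- + (suc (2 ℕ.* m) ℕ.^ 2) ≡ ℤ.- + (m ℕ.* suc m ℕ.* 4)
  numerator≡ = ≡.trans (≡.cong (λ k → + 1 ℤ.- + k) square≡)
    (ℤ.⊖-≤ {1} {suc (m ℕ.* suc m ℕ.* 4)} (ℕ.s≤s ℕ.z≤n))

theorem4p4 : (n s : ℕ) → 0 ℕ.< n → ¬ (2 ∣ n) → s ℕ.≤ (n ℕ.∸ 1) ℕ./ 2 →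
    (let open RationalFunctions in
    ∑[ k ⩽ (n ℕ.∸ 1) ℕ./ 2 ]
    (⟨ a * q ⨾ q ^ 2 ⟩ k * ⟨ q / a ⨾ q ^ 2 ⟩ (k ℕ.+ s))
    / (⟨ q ^ 2 ⨾ q ^ 2 ⟩ k * ⟨ q ^ 2 ⨾ q ^ 2 ⟩ (k ℕ.+ s)))
    ≡
    (let open RationalFunctions in
    (- 1#) ^ ((n ℕ.∸ 1) ℕ./ 2) * q ^ᶻ ((+ 1 ℤ.- + (n ℕ.^ 2)) ℤ./ + 4))
    [mod
    (let open Polynomials in
    (1# - a * q ^ n) * (a - q ^ n))
    ]
theorem4p4 (suc k) s _ 2∤n s≤m =
  Generic.∑term-congruent ℚ[q].polyDomain ℚ[q].X a≉0 q≉0 ⟨q²⨾q²⟩≉0 m s s≤m 1+k≡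
    (≡.trans (≡.cong (λ n → (+ 1 ℤ.- + (n ℕ.^ 2)) ℤ./ + 4) 1+k≡) (exponent≡ m))
  where
  open Nonvanishing using (a≉0; q≉0; ⟨q²⨾q²⟩≉0)
  m : ℕ
  m = k ℕ./ 2
  1+k≡ : suc k ≡ suc (2 ℕ.* m)
  1+k≡ = odd⇒1+2* k 2∤n
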